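{- Let $T=\{1324,1342,4123\}$. Then $$F_T(x)=\frac{1-3x+x^2-x^3-(1-x)^3\sqrt{1-4x}}{2x(1-4x+4x^2-x^3)}.$$
   Context: $S_n(T)$ denotes the set of permutations $\pi$ of $[n]=\{1,\dots,n\}$ (one-line notation) that avoid every pattern $\tau\in T$, i.e. no subsequence of $\pi$ is order-isomorphic to $\tau$. $F_T(x)=\sum_{n\ge 0}|S_n(T)|x^n$, a formal power series, with $|S_0(T)|=1$. Here $\sqrt{1-4x}$ is the formal power series with constant term $1$ whose square is $1-4x$. -}

module Defs where

open import Data.Fin.Base as Fin using (Fin; toℕ; fromℕ; inject₁)
open import Data.Fin.Properties as Fin using (toℕ≤pred[n]; toℕ-inject₁; toℕ-fromℕ)
open import Data.Integer.Base as ℤ using (ℤ; +_; 0ℤ; 1ℤ)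
open import Data.Integer.Properties as ℤ using (+-*-semiring)
open import Data.Integer.Tactic.RingSolver using (solve-∀)
open import Data.List.Base
  using (List; []; _∷_; _++_; [_]; length; lookup; map; filter; upTo; cartesianProductWith)
open import Data.List.Membership.Propositional using (_∈_; find; lose)
open import Data.List.Membership.DecPropositional using (_∈?_)
open import Data.List.Membership.Propositional.Properties
  using (∈-∃++; ∈-++⁺ˡ; ∈-++⁺ʳ; ∈-++⁻; ∈-map⁺; ∈-map⁻; ∈-filter⁺; ∈-filter⁻; ∈-cartesianProductWith⁺)
open import Data.List.Properties using (length-map; length-upTo; ∷-injective)
open import Data.List.Relation.Binary.Permutation.Propositional
  using (_↭_; ↭-refl; ↭-sym; ↭-trans; prep)
open import Data.List.Relation.Binary.Permutation.Propositional.Properties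
  using (↭-length; ↭-empty-inv; ∈-resp-↭; drop-∷; shift)
open import Data.List.Relation.Binary.Sublist.Propositional using (_⊆_; []; _∷_; _∷ʳ_)
open import Data.List.Relation.Unary.All as All using (All; []; _∷_; all?)
open import Data.List.Relation.Unary.Any using (here; any?)
open import Data.List.Relation.Unary.Unique.Propositional using (Unique; []; _∷_)
import Data.List.Relation.Unary.Unique.Propositional.Properties as Unique
open import Data.Nat.Base as ℕ using (ℕ; zero; suc; _∸_; _≤_; _<_; s≤s)
import Data.Nat.Properties as ℕ
open import Data.Product using (Σ-syntax; ∃-syntax; _×_; _,_; proj₁; proj₂)
open import Data.Sum.Base using (inj₁; inj₂)
open import Function.Base using (_∘_; case_of_)
open import Function.Bundles using (_⇔_; mk⇔; Equivalence)
open import Relation.Nullary using (¬_; Dec; yes; no; ¬?; _×-dec_; _→-dec_)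
open import Relation.Nullary.Decidable using (map′)
open import Relation.Binary.PropositionalEquality
  using (_≡_; refl; sym; trans; cong; cong₂; subst; module ≡-Reasoning)

open import Algebra.Properties.Semiring.Sum +-*-semiring
  using (sum; sum⁺-syntax; sum-cong-≗; sum-init-last; *-distribˡ-sum)

[1⋯_] : ℕ → List ℕ
[1⋯ n ] = map suc (upTo n)

-- One-line notation.
IsPermutationOf : ℕ → List ℕ → Set
IsPermutationOf n π = π ↭ [1⋯ n ]

OrderIsomorphic : List ℕ → List ℕ → Set
OrderIsomorphic σ τ =
  Σ[ eq ∈ length σ ≡ length τ ]
  (∀ i j → (lookup σ i < lookup σ j) ⇔
           (lookup τ (Fin.cast eq i) < lookup τ (Fin.cast eq j)))

-- _⊆_ is the (not necessarily contiguous) sublist relation.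
_Contains_ : List ℕ → List ℕ → Set
π Contains τ = ∃[ σ ] (σ ⊆ π × OrderIsomorphic σ τ)

_Avoids_ : List ℕ → List (List ℕ) → Set
π Avoids T = All (λ τ → ¬ (π Contains τ)) T

orderIsomorphic? : ∀ σ τ → Dec (OrderIsomorphic σ τ)
orderIsomorphic? σ τ with length σ ℕ.≟ length τ
... | no  ≢  = no (≢ ∘ proj₁)
... | yes eq = map′ (eq ,_)
  (λ (eq′ , iso) → subst (λ e → ∀ i j → (lookup σ i < lookup σ j) ⇔
      (lookup τ (Fin.cast e i) < lookup τ (Fin.cast e j))) (ℕ.≡-irrelevant eq′ eq) iso)
  (Fin.all? λ i → Fin.all? λ j →
    let p? = lookup σ i ℕ.<? lookup σ j
        q? = lookup τ (Fin.cast eq i) ℕ.<? lookup τ (Fin.cast eq j)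
    in map′ (λ (f , g) → mk⇔ f g) (λ e → Equivalence.to e , Equivalence.from e)
         ((p? →-dec q?) ×-dec (q? →-dec p?)))

sublists : List ℕ → List (List ℕ)
sublists []       = [ [] ]
sublists (x ∷ xs) = map (x ∷_) (sublists xs) ++ sublists xs

∈-sublists⁺ : ∀ {σ π} → σ ⊆ π → σ ∈ sublists π
∈-sublists⁺ []          = here refl
∈-sublists⁺ (x ∷ʳ p)    = ∈-++⁺ʳ _ (∈-sublists⁺ p)
∈-sublists⁺ (refl ∷ p)  = ∈-++⁺ˡ (∈-map⁺ _ (∈-sublists⁺ p))

∈-sublists⁻ : ∀ {σ} π → σ ∈ sublists π → σ ⊆ π
∈-sublists⁻ []       (here refl) = []
∈-sublists⁻ (x ∷ π) σ∈ with ∈-++⁻ (map (x ∷_) (sublists π)) σ∈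
... | inj₂ σ∈′ = x ∷ʳ ∈-sublists⁻ π σ∈′
... | inj₁ σ∈′ with _ , ρ∈ , refl ← ∈-map⁻ (x ∷_) σ∈′ = refl ∷ ∈-sublists⁻ π ρ∈

contains? : ∀ π τ → Dec (π Contains τ)
contains? π τ = map′
  (λ p → let σ , σ∈ , iso = find p in σ , ∈-sublists⁻ π σ∈ , iso)
  (λ (σ , σ⊆ , iso) → lose (∈-sublists⁺ σ⊆) iso)
  (any? (λ σ → orderIsomorphic? σ τ) (sublists π))

avoids? : ∀ π T → Dec (π Avoids T)
avoids? π T = all? (λ τ → ¬? (contains? π τ)) T

_↭?_ : (xs ys : List ℕ) → Dec (xs ↭ ys)
[] ↭? []       = yes ↭-refl
[] ↭? (_ ∷ _)  = no λ p → case ↭-length p of λ ()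
(x ∷ xs) ↭? ys with _∈?_ ℕ._≟_ x ys
... | no  x∉ = no λ p → x∉ (∈-resp-↭ p (here refl))
... | yes x∈ with as , bs , refl ← ∈-∃++ x∈ =
  map′ (λ p → ↭-trans (prep x p) (↭-sym (shift x as bs)))
       (λ p → drop-∷ (↭-trans p (shift x as bs)))
       (xs ↭? (as ++ bs))

words : List ℕ → ℕ → List (List ℕ)
words alphabet zero    = [ [] ]
words alphabet (suc k) = cartesianProductWith _∷_ alphabet (words alphabet k)

-- Lists each T-avoiding permutation of [n] exactly once: see ∈-S and S-unique.
S : ℕ → List (List ℕ) → List (List ℕ)
S n T = filter (λ π → (π ↭? [1⋯ n ]) ×-dec avoids? π T) (words [1⋯ n ] n)

∣S∣ : ℕ → List (List ℕ) → ℕ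
∣S∣ n T = length (S n T)

∈-words : ∀ {alphabet} w → All (_∈ alphabet) w → w ∈ words alphabet (length w)
∈-words []      []       = here refl
∈-words (x ∷ w) (p ∷ ps) = ∈-cartesianProductWith⁺ _∷_ p (∈-words w ps)

words-unique : ∀ {alphabet} → Unique alphabet → ∀ k → Unique (words alphabet k)
words-unique u zero    = [] ∷ []
words-unique u (suc k) = Unique.cartesianProductWith⁺ _∷_ ∷-injective u (words-unique u k)

∈-S : ∀ n T π → π ∈ S n T ⇔ (IsPermutationOf n π × π Avoids T)
∈-S n T π = mk⇔ (proj₂ ∘ ∈-filter⁻ P? {xs = words [1⋯ n ] n})
                (λ p → ∈-filter⁺ P? (isWord (proj₁ p)) p)
  where
  P? = λ π → (π ↭? [1⋯ n ]) ×-dec avoids? π T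

  isWord : IsPermutationOf n π → π ∈ words [1⋯ n ] n
  isWord p = subst (λ k → π ∈ words [1⋯ n ] k)
    (trans (↭-length p) (trans (length-map suc (upTo n)) (length-upTo n)))
    (∈-words π (All.tabulate (∈-resp-↭ p)))

S-unique : ∀ n T → Unique (S n T)
S-unique n T = Unique.filter⁺ _ (words-unique (Unique.map⁺ ℕ.suc-injective (Unique.upTo⁺ n)) n)

-- ℤ[[x]]
Series : Set
Series = ℕ → ℤ

infix  4 _≈_ _≈[_/_]
infixl 6 _+_ _-_
infixl 7 _*_ _·_
infixr 8 _^_

_≈_ : Series → Series → Set
f ≈ g = ∀ n → f n ≡ g n

𝟘 𝟙 X : Series
𝟘 _             = 0ℤ
𝟙 zero          = 1ℤ
𝟙 (suc _)       = 0ℤ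
X zero          = 0ℤ
X (suc zero)    = 1ℤ
X (suc (suc _)) = 0ℤ

_+_ _-_ _*_ : Series → Series → Series
(f + g) n = f n ℤ.+ g n
(f - g) n = f n ℤ.- g n
(f * g) n = ∑[ i ≤ n ] (f (toℕ i) ℤ.* g (n ∸ toℕ i))

_·_ : ℕ → Series → Series
(m · f) n = + m ℤ.* f n

_^_ : Series → ℕ → Series
f ^ zero  = 𝟙
f ^ suc k = f * f ^ k

-- f = p / q in the field of fractions of ℤ[[x]]; the denominator may have
-- constant term 0.
_≈[_/_] : Series → Series → Series → Set
f ≈[ p / q ] = ¬ (q ≈ 𝟘) × f * q ≈ p

-- s = √f, normalised by its constant term.
_IsSqrtOf_ : Series → Series → Set
s IsSqrtOf f = s 0 ≡ 1ℤ × s * s ≈ f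

F : List (List ℕ) → Series
F T n = + ∣S∣ n T

-- √(1 - 4x) exists in ℤ[[x]]: it is 1 - 2xC, where C = 1 + xC².

-- C₀ = 0, Cₖ₊₁ = 1 + xCₖ²; Cₖ agrees with C below degree k.
approx : ℕ → Series
approx zero    _       = 0ℤ
approx (suc k) zero    = 1ℤ
approx (suc k) (suc n) = (approx k * approx k) n

*-cong-≤ : ∀ {f f′ g g′ : Series} n → (∀ i → i ≤ n → f i ≡ f′ i) →
           (∀ i → i ≤ n → g i ≡ g′ i) → (f * g) n ≡ (f′ * g′) n
*-cong-≤ n f≡ g≡ = sum-cong-≗ λ i →
  cong₂ ℤ._*_ (f≡ (toℕ i) (toℕ≤pred[n] i)) (g≡ (n ∸ toℕ i) (ℕ.m∸n≤m n (toℕ i)))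

catalan : Series
catalan n = approx (suc n) n

approx-stable : ∀ k l n → n < k → n < l → approx k n ≡ approx l n
approx-stable (suc k) (suc l) zero    _         _         = refl
approx-stable (suc k) (suc l) (suc n) (s≤s n<k) (s≤s n<l) = *-cong-≤ n eq eq
  where
  eq : ∀ i → i ≤ n → approx k i ≡ approx l i
  eq i i≤n = approx-stable k l i (ℕ.≤-<-trans i≤n n<k) (ℕ.≤-<-trans i≤n n<l)

catalan-suc : ∀ n → catalan (suc n) ≡ (catalan * catalan) n
catalan-suc n = *-cong-≤ n eq eq
  where
  eq : ∀ i → i ≤ n → approx (suc n) i ≡ catalan i
  eq i i≤n = approx-stable (suc n) (suc i) i (s≤s i≤n) ℕ.≤-refl

√[1-4X] : Series
√[1-4X] zero    = 1ℤ
√[1-4X] (suc n) = ℤ.- (+ 2) ℤ.* catalan n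

√[1-4X]-isSqrt : √[1-4X] IsSqrtOf (𝟙 - 4 · X)
√[1-4X]-isSqrt = refl , square
  where
  open ≡-Reasoning
  s = √[1-4X]
  c = catalan

  square : s * s ≈ 𝟙 - 4 · X
  square zero          = refl
  square (suc zero)    = refl
  square (suc (suc n)) = begin
    1ℤ ℤ.* s (suc (suc n)) ℤ.+ sum t
      ≡⟨ cong (ℤ._+_ (1ℤ ℤ.* s (suc (suc n)))) (sum-init-last t) ⟩
    1ℤ ℤ.* s (suc (suc n)) ℤ.+ (sum (t ∘ inject₁) ℤ.+ t (fromℕ (suc n)))
      ≡⟨ cong₂ (λ a b → 1ℤ ℤ.* s (suc (suc n)) ℤ.+ (a ℤ.+ b)) middle end ⟩
    1ℤ ℤ.* (ℤ.- (+ 2) ℤ.* c (suc n)) ℤ.+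
      ((+ 4) ℤ.* (c * c) n ℤ.+ (ℤ.- (+ 2) ℤ.* c (suc n)) ℤ.* 1ℤ)
      ≡⟨ cong (λ a → 1ℤ ℤ.* (ℤ.- (+ 2) ℤ.* c (suc n)) ℤ.+
           ((+ 4) ℤ.* a ℤ.+ (ℤ.- (+ 2) ℤ.* c (suc n)) ℤ.* 1ℤ)) (sym (catalan-suc n)) ⟩
    1ℤ ℤ.* (ℤ.- (+ 2) ℤ.* c (suc n)) ℤ.+
      ((+ 4) ℤ.* c (suc n) ℤ.+ (ℤ.- (+ 2) ℤ.* c (suc n)) ℤ.* 1ℤ)
      ≡⟨ cancel (c (suc n)) ⟩
    0ℤ ∎
    where
    t : Fin (suc (suc n)) → ℤ
    t i = s (suc (toℕ i)) ℤ.* s (suc n ∸ toℕ i)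

    cancel : ∀ a → 1ℤ ℤ.* (ℤ.- (+ 2) ℤ.* a) ℤ.+
                   ((+ 4) ℤ.* a ℤ.+ (ℤ.- (+ 2) ℤ.* a) ℤ.* 1ℤ) ≡ 0ℤ
    cancel = solve-∀

    four : ∀ a b → (ℤ.- (+ 2) ℤ.* a) ℤ.* (ℤ.- (+ 2) ℤ.* b) ≡ (+ 4) ℤ.* (a ℤ.* b)
    four = solve-∀

    end : t (fromℕ (suc n)) ≡ (ℤ.- (+ 2) ℤ.* c (suc n)) ℤ.* 1ℤ
    end = begin
      s (suc (toℕ (fromℕ (suc n)))) ℤ.* s (suc n ∸ toℕ (fromℕ (suc n)))
        ≡⟨ cong (λ k → s (suc k) ℤ.* s (suc n ∸ k)) (toℕ-fromℕ (suc n)) ⟩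
      s (suc (suc n)) ℤ.* s (n ∸ n)
        ≡⟨ cong (λ k → s (suc (suc n)) ℤ.* s k) (ℕ.n∸n≡0 n) ⟩
      s (suc (suc n)) ℤ.* 1ℤ ∎

    middle : sum (t ∘ inject₁) ≡ (+ 4) ℤ.* (c * c) n
    middle = trans (sum-cong-≗ term) (sym (*-distribˡ-sum {suc n} (+ 4) (λ i → c (toℕ i) ℤ.* c (n ∸ toℕ i))))
      where
      term : ∀ i → t (inject₁ i) ≡ (+ 4) ℤ.* (c (toℕ i) ℤ.* c (n ∸ toℕ i))
      term i = begin
        s (suc (toℕ (inject₁ i))) ℤ.* s (suc n ∸ toℕ (inject₁ i))
          ≡⟨ cong (λ k → s (suc k) ℤ.* s (suc n ∸ k)) (toℕ-inject₁ i) ⟩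
        s (suc (toℕ i)) ℤ.* s (suc n ∸ toℕ i)
          ≡⟨ cong (λ k → s (suc (toℕ i)) ℤ.* s k) (ℕ.+-∸-assoc 1 (toℕ≤pred[n] i)) ⟩
        s (suc (toℕ i)) ℤ.* s (suc (n ∸ toℕ i))
          ≡⟨ four (c (toℕ i)) (c (n ∸ toℕ i)) ⟩
        (+ 4) ℤ.* (c (toℕ i) ℤ.* c (n ∸ toℕ i)) ∎

{-# OPTIONS --safe #-}
module Submission where

-- Build avoiders from right to left: a ∷ σ, with the values of σ that are at
-- least a raised by one, avoids T iff σ does, no 213 or 231 of σ has all
-- values ≥ a, and no 123 of σ has all values < a. The first condition on a is
-- a lower bound and the second an upper bound, so the admissible a form an
-- interval, and a few parameters of σ determine the same data for a ∷ σ. The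
-- resulting generating tree has three kinds of nodes. The 123-avoiding σ
-- ("full": no upper bound) form a Catalan tree; each of them, other than the
-- decreasing ones, has one further child, "wide", below which only wide nodes
-- (three admissible a) and "narrow" nodes (two) occur. With C = 1 + xC² this
-- gives F = C + x (C - 1/(1 - x)) W, where W = 1/(1 - 3x + x²) counts the
-- descendants of a wide node.

open import Defs
open import Algebra.Bundles using (CommutativeRing)
import Algebra.Solver.Ring
open import Algebra.Solver.Ring.AlmostCommutativeRing using (fromCommutativeRing; _-Raw-AlmostCommutative⟶_)
open import Data.Fin.Base as Fin using (Fin; zero; suc)
open import Data.Fin using (#_)
open import Data.Integer.Base as ℤ using (ℤ; +_; 0ℤ; 1ℤ)
import Data.Integer.Properties as ℤ
open import Data.Integer.Tactic.RingSolver using (solve-∀)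
open import Data.List.Base using (List; []; _∷_; _++_; length; lookup; map; foldr; concatMap; upTo)
open import Data.List.Membership.Propositional using (_∈_)
open import Data.List.Membership.Propositional.Properties
  using (∈-++⁺ˡ; ∈-++⁺ʳ; ∈-++⁻; ∈-map⁺; ∈-map⁻; ∈-lookup)
open import Data.List.Membership.Propositional.Properties.WithK using (unique∧set⇒bag)
open import Data.List.Properties
  using (length-map; map-injective; map-∘; map-++; map-upTo; map-id-local; ∷-injective)
open import Data.List.Relation.Binary.BagAndSetEquality using (∼bag⇒↭)
open import Data.List.Relation.Binary.Permutation.Propositional
  using (_↭_; ↭-refl; ↭-sym; ↭-trans; ↭-reflexive; prep; swap; module PermutationReasoning)
open import Data.List.Relation.Binary.Permutation.Propositional.Properties
  using (↭-length; ↭-empty-inv; ∈-resp-↭; drop-∷; ↭-map-inv) renaming (map⁺ to ↭-map⁺)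
open import Data.List.Relation.Binary.Sublist.Propositional as Sublist using (_⊆_; []; _∷_; _∷ʳ_)
open import Data.List.Relation.Binary.Sublist.Propositional.Properties using () renaming (map⁺ to ⊆-map⁺)
open import Data.List.Relation.Unary.All as All using (All; []; _∷_)
open import Data.List.Relation.Unary.All.Properties using () renaming (map⁺ to All-map⁺)
open import Data.List.Relation.Unary.Any using (here; there)
open import Data.List.Relation.Unary.Unique.Propositional using (Unique; []; _∷_)
import Data.List.Relation.Unary.Unique.Propositional.Properties as Unique
open import Data.Maybe.Base using (Maybe; just; nothing)
open import Data.Nat.Base as ℕ using (ℕ; zero; suc; _≤_; _<_; z≤n; s≤s; z<s; s<s)
open import Data.Nat.Induction using (<-rec)
import Data.Nat.Properties as ℕ
open import Data.Product using (∃₂; ∃-syntax; _×_; _,_; proj₁; proj₂)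
open import Data.Sum.Base as Sum using (_⊎_; inj₁; inj₂; [_,_]′)
open import Function.Base using (_∘_; case_of_)
open import Function.Bundles using (mk⇔; Equivalence)
open import Level using (0ℓ)
open import Relation.Binary.Definitions using (tri<; tri≈; tri>)
open import Relation.Binary.PropositionalEquality
  using (_≡_; _≢_; refl; sym; trans; cong; cong₂; subst; subst₂; module ≡-Reasoning)
open import Relation.Nullary using (¬_; yes; no; contradiction; _×-dec_)
open import Relation.Nullary.Decidable using (True; toWitness)

-- Patterns in a ∷ σ

-- `punchIn` on ℕ: the increasing map that misses exactly the value `a`.
bump : ℕ → ℕ → ℕ
bump zero    v       = suc v
bump (suc a) zero    = zero
bump (suc a) (suc v) = suc (bump a v)

prepend : ℕ → List ℕ → List ℕ
prepend a σ = a ∷ map (bump a) σ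

bump-< : ∀ {a v} → v < a → bump a v ≡ v
bump-< {suc a} {zero}  _         = refl
bump-< {suc a} {suc v} (s≤s v<a) = cong suc (bump-< v<a)

bump-≥ : ∀ {a v} → a ≤ v → bump a v ≡ suc v
bump-≥ {zero}          _         = refl
bump-≥ {suc a} {suc v} (s≤s a≤v) = cong suc (bump-≥ a≤v)

bump-mono-< : ∀ a {u v} → u < v → bump a u < bump a v
bump-mono-< zero    u<v                     = s<s u<v
bump-mono-< (suc a) {zero}  {suc v} _       = z<s
bump-mono-< (suc a) {suc u} {suc v} (s≤s p) = s<s (bump-mono-< a p)

bump-injective : ∀ a {u v} → bump a u ≡ bump a v → u ≡ v
bump-injective a {u} {v} eq with ℕ.<-cmp u v
... | tri< u<v _ _ = contradiction eq (ℕ.<⇒≢ (bump-mono-< a u<v))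
... | tri≈ _ u≡v _ = u≡v
... | tri> _ _ v<u = contradiction (sym eq) (ℕ.<⇒≢ (bump-mono-< a v<u))

bump-cancel-< : ∀ a {u v} → bump a u < bump a v → u < v
bump-cancel-< a {u} {v} lt with ℕ.<-cmp u v
... | tri< u<v _ _  = u<v
... | tri≈ _ refl _ = contradiction lt (ℕ.<-irrefl refl)
... | tri> _ _ v<u  = contradiction lt (ℕ.<-asym (bump-mono-< a v<u))

≤-bump : ∀ a v → v ≤ bump a v
≤-bump zero    v       = ℕ.n≤1+n v
≤-bump (suc a) zero    = z≤n
≤-bump (suc a) (suc v) = s≤s (≤-bump a v)

bump-≤ : ∀ a v → bump a v ≤ suc v
bump-≤ zero    v       = ℕ.≤-refl
bump-≤ (suc a) zero    = z≤n
bump-≤ (suc a) (suc v) = s≤s (bump-≤ a v)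

bump-cancel-≤ : ∀ {a v} → a ≤ bump a v → a ≤ v
bump-cancel-≤ {a} {v} a≤ with ℕ.<-≤-connex v a
... | inj₁ v<a = subst (a ≤_) (bump-< v<a) a≤
... | inj₂ a≤v = a≤v

<-bump⁻ : ∀ {a v} → a < bump a v → a ≤ v
<-bump⁻ = bump-cancel-≤ ∘ ℕ.<⇒≤

<-bump⁺ : ∀ {a v} → a ≤ v → a < bump a v
<-bump⁺ {a} a≤v = subst (a <_) (sym (bump-≥ a≤v)) (s≤s a≤v)

bump-<⁺ : ∀ {a v} → v < a → bump a v < a
bump-<⁺ {a} v<a = subst (_< a) (sym (bump-< v<a)) v<a

bump-<⁻ : ∀ {a v} → bump a v < a → v < a
bump-<⁻ {a} {v} lt = ℕ.≤-<-trans (≤-bump a v) lt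

bump-<-suc⁻ : ∀ {a d v} → a ≤ d → bump a v < suc d → v < d
bump-<-suc⁻ {a} {d} {v} a≤d lt with ℕ.<-≤-connex v a
... | inj₁ v<a = ℕ.<-≤-trans v<a a≤d
... | inj₂ a≤v = ℕ.s≤s⁻¹ (subst (_< suc d) (bump-≥ a≤v) lt)

⊆-map⁻ : ∀ (f : ℕ → ℕ) {τ} σ → τ ⊆ map f σ → ∃[ ρ ] (τ ≡ map f ρ × ρ ⊆ σ)
⊆-map⁻ f []      []         = [] , refl , []
⊆-map⁻ f (x ∷ σ) (_ ∷ʳ p)   with ρ , refl , q ← ⊆-map⁻ f σ p = ρ , refl , x ∷ʳ q
⊆-map⁻ f (x ∷ σ) (refl ∷ p) with ρ , refl , q ← ⊆-map⁻ f σ p = x ∷ ρ , refl , refl ∷ q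

lift-⊆ : ∀ a {τ σ} → τ ⊆ σ → map (bump a) τ ⊆ prepend a σ
lift-⊆ a p = a ∷ʳ ⊆-map⁺ (bump a) p

-- Such a pair turns into a 123 once a value `a ≤ b` is put in front, so it governs the upper bound
-- for later insertions.
Ascent : ℕ → ℕ → List ℕ → Set
Ascent b d σ = ∃₂ λ x y → (x ∷ y ∷ []) ⊆ σ × b ≤ x × x < y × y < d

-- Blocks every inserted `a ≥ d`, which would be the 4 of a 4123.
Low123 : ℕ → List ℕ → Set
Low123 d σ = ∃₂ λ x y → ∃[ z ] ((x ∷ y ∷ z ∷ []) ⊆ σ × x < y × y < z × z < d)

-- Blocks every inserted `a ≤ b`, which would be the 1 of a 1324 or 1342.
High213∨231 : ℕ → List ℕ → Set
High213∨231 b σ = ∃₂ λ x y → ∃[ z ]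
  (((y ∷ x ∷ z ∷ []) ⊆ σ ⊎ (y ∷ z ∷ x ∷ []) ⊆ σ) × b ≤ x × x < y × y < z)

-- Letters are named by rank, so that 1324, 1342 and 4123, in this order, share the same
-- inequalities.
Forbidden : List ℕ → Set
Forbidden σ = ∃₂ λ w x → ∃₂ λ y z →
  ((w ∷ y ∷ x ∷ z ∷ []) ⊆ σ ⊎ (w ∷ y ∷ z ∷ x ∷ []) ⊆ σ ⊎ (z ∷ w ∷ x ∷ y ∷ []) ⊆ σ)
  × w < x × x < y × y < z

Low123-mono : ∀ {c d σ} → c ≤ d → Low123 c σ → Low123 d σ
Low123-mono c≤d (x , y , z , p , x<y , y<z , z<c) = x , y , z , p , x<y , y<z , ℕ.<-≤-trans z<c c≤d

High-mono : ∀ {b c σ} → b ≤ c → High213∨231 c σ → High213∨231 b σ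
High-mono b≤c (x , y , z , p , c≤x , rest) = x , y , z , p , ℕ.≤-trans b≤c c≤x , rest

-- The first letter is the smallest in 1324 and 1342 and the largest in 4123, so an occurrence using
-- the head `a` leaves a 213 or 231 above `a`, or a 123 below it.
Forbidden-prepend⁻ : ∀ a σ → Forbidden (prepend a σ) → Forbidden σ ⊎ High213∨231 a σ ⊎ Low123 a σ
Forbidden-prepend⁻ a σ (w , x , y , z , inj₁ (refl ∷ p) , a<x , x<y , y<z)
  with y′ ∷ x′ ∷ z′ ∷ [] , refl , q ← ⊆-map⁻ (bump a) σ p
  = inj₂ (inj₁ (x′ , y′ , z′ , inj₁ q , <-bump⁻ a<x , bump-cancel-< a x<y , bump-cancel-< a y<z))
Forbidden-prepend⁻ a σ (w , x , y , z , inj₂ (inj₁ (refl ∷ p)) , a<x , x<y , y<z)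
  with y′ ∷ z′ ∷ x′ ∷ [] , refl , q ← ⊆-map⁻ (bump a) σ p
  = inj₂ (inj₁ (x′ , y′ , z′ , inj₂ q , <-bump⁻ a<x , bump-cancel-< a x<y , bump-cancel-< a y<z))
Forbidden-prepend⁻ a σ (w , x , y , z , inj₂ (inj₂ (refl ∷ p)) , w<x , x<y , y<a)
  with w′ ∷ x′ ∷ y′ ∷ [] , refl , q ← ⊆-map⁻ (bump a) σ p
  = inj₂ (inj₂ (w′ , x′ , y′ , q , bump-cancel-< a w<x , bump-cancel-< a x<y , bump-<⁻ y<a))
Forbidden-prepend⁻ a σ (w , x , y , z , inj₁ (_ ∷ʳ p) , w<x , x<y , y<z)
  with w′ ∷ y′ ∷ x′ ∷ z′ ∷ [] , refl , q ← ⊆-map⁻ (bump a) σ p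
  = inj₁ (w′ , x′ , y′ , z′ , inj₁ q , bump-cancel-< a w<x , bump-cancel-< a x<y , bump-cancel-< a y<z)
Forbidden-prepend⁻ a σ (w , x , y , z , inj₂ (inj₁ (_ ∷ʳ p)) , w<x , x<y , y<z)
  with w′ ∷ y′ ∷ z′ ∷ x′ ∷ [] , refl , q ← ⊆-map⁻ (bump a) σ p
  = inj₁ (w′ , x′ , y′ , z′ , inj₂ (inj₁ q) , bump-cancel-< a w<x , bump-cancel-< a x<y , bump-cancel-< a y<z)
Forbidden-prepend⁻ a σ (w , x , y , z , inj₂ (inj₂ (_ ∷ʳ p)) , w<x , x<y , y<z)
  with z′ ∷ w′ ∷ x′ ∷ y′ ∷ [] , refl , q ← ⊆-map⁻ (bump a) σ p
  = inj₁ (w′ , x′ , y′ , z′ , inj₂ (inj₂ q) , bump-cancel-< a w<x , bump-cancel-< a x<y , bump-cancel-< a y<z)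

Forbidden-prepend⁺ : ∀ a σ → Forbidden σ ⊎ High213∨231 a σ ⊎ Low123 a σ → Forbidden (prepend a σ)
Forbidden-prepend⁺ a σ (inj₁ (w , x , y , z , p , w<x , x<y , y<z)) =
  bump a w , bump a x , bump a y , bump a z ,
  Sum.map (lift-⊆ a) (Sum.map (lift-⊆ a) (lift-⊆ a)) p ,
  bump-mono-< a w<x , bump-mono-< a x<y , bump-mono-< a y<z
Forbidden-prepend⁺ a σ (inj₂ (inj₁ (x , y , z , p , a≤x , x<y , y<z))) =
  a , bump a x , bump a y , bump a z ,
  [ (λ q → inj₁ (refl ∷ ⊆-map⁺ (bump a) q)) , (λ q → inj₂ (inj₁ (refl ∷ ⊆-map⁺ (bump a) q))) ]′ p ,
  <-bump⁺ a≤x , bump-mono-< a x<y , bump-mono-< a y<z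
Forbidden-prepend⁺ a σ (inj₂ (inj₂ (x , y , z , p , x<y , y<z , z<a))) =
  bump a x , bump a y , bump a z , a , inj₂ (inj₂ (refl ∷ ⊆-map⁺ (bump a) p)) ,
  bump-mono-< a x<y , bump-mono-< a y<z , bump-<⁺ z<a

Ascent-prepend-head : ∀ {a d y σ} → y ∈ σ → a ≤ y → suc y < d → Ascent a d (prepend a σ)
Ascent-prepend-head {a} {d} {y} y∈σ a≤y y<d =
  a , bump a y , refl ∷ ⊆-map⁺ (bump a) (Sublist.from∈ y∈σ) , ℕ.≤-refl , <-bump⁺ a≤y , ℕ.≤-<-trans (bump-≤ a y) y<d

Ascent-prepend⁺ : ∀ {a b d σ} → a ≤ b → Ascent b d σ → Ascent (suc b) (suc d) (prepend a σ)
Ascent-prepend⁺ {a} {b} a≤b (x , y , p , b≤x , x<y , y<d) =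
  bump a x , bump a y , lift-⊆ a p ,
  subst (suc b ≤_) (sym (bump-≥ (ℕ.≤-trans a≤b b≤x))) (s≤s b≤x) ,
  bump-mono-< a x<y , ℕ.≤-<-trans (bump-≤ a y) (s≤s y<d)

Ascent-prepend⁻ : ∀ {a b d σ} → a ≤ b → Ascent (suc b) d (prepend a σ) → Ascent b d σ
Ascent-prepend⁻ a≤b (x , y , refl ∷ p , b<a , _) = contradiction b<a (ℕ.≤⇒≯ a≤b)
Ascent-prepend⁻ {a} {b} {σ = σ} a≤b (x , y , _ ∷ʳ p , b<x , x<y , y<d)
  with x′ ∷ y′ ∷ [] , refl , q ← ⊆-map⁻ (bump a) σ p
  = x′ , y′ , q , ℕ.s≤s⁻¹ (ℕ.≤-trans b<x (bump-≤ a x′)) , bump-cancel-< a x<y , ℕ.≤-<-trans (≤-bump a y′) y<d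

Low123-prepend-head : ∀ {a d σ} → Ascent a d σ → Low123 (suc d) (prepend a σ)
Low123-prepend-head {a} (x , y , p , a≤x , x<y , y<d) =
  a , bump a x , bump a y , refl ∷ ⊆-map⁺ (bump a) p ,
  <-bump⁺ a≤x , bump-mono-< a x<y , ℕ.≤-<-trans (bump-≤ a y) (s≤s y<d)

Low123-prepend⁺ : ∀ {a d σ} → Low123 d σ → Low123 (suc d) (prepend a σ)
Low123-prepend⁺ {a} (x , y , z , p , x<y , y<z , z<d) =
  bump a x , bump a y , bump a z , lift-⊆ a p ,
  bump-mono-< a x<y , bump-mono-< a y<z , ℕ.≤-<-trans (bump-≤ a z) (s≤s z<d)

-- The hypothesis `a ≤ d` lets the bound drop by one: values below `a` are not raised but already
-- lie below `d`, and all others are raised.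
Low123-prepend⁻ : ∀ {a d σ} → a ≤ d → Low123 (suc d) (prepend a σ) → Low123 d σ ⊎ Ascent a d σ
Low123-prepend⁻ {a} {σ = σ} a≤d (x , y , z , refl ∷ p , a<y , y<z , z<d)
  with y′ ∷ z′ ∷ [] , refl , q ← ⊆-map⁻ (bump a) σ p
  = inj₂ (y′ , z′ , q , <-bump⁻ a<y , bump-cancel-< a y<z , bump-<-suc⁻ a≤d z<d)
Low123-prepend⁻ {a} {σ = σ} a≤d (x , y , z , _ ∷ʳ p , x<y , y<z , z<d)
  with x′ ∷ y′ ∷ z′ ∷ [] , refl , q ← ⊆-map⁻ (bump a) σ p
  = inj₁ (x′ , y′ , z′ , q , bump-cancel-< a x<y , bump-cancel-< a y<z , bump-<-suc⁻ a≤d z<d)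

-- At most one value fits between `b` and `d`.
¬Ascent-empty : ∀ {b d σ} → d ≤ suc b → ¬ Ascent b d σ
¬Ascent-empty d≤1+b (x , y , p , b≤x , x<y , y<d) =
  ℕ.<-irrefl refl (ℕ.≤-<-trans b≤x (ℕ.<-≤-trans x<y (ℕ.s≤s⁻¹ (ℕ.<-≤-trans y<d d≤1+b))))

-- An occurrence of 213 or 231 starting with the head `a` contains a letter smaller than `a`.
High-prepend⁻ : ∀ {a σ} → High213∨231 a (prepend a σ) → High213∨231 a σ
High-prepend⁻ (x , y , z , inj₁ (refl ∷ p) , a≤x , x<a , _) = contradiction a≤x (ℕ.<⇒≱ x<a)
High-prepend⁻ (x , y , z , inj₂ (refl ∷ p) , a≤x , x<a , _) = contradiction a≤x (ℕ.<⇒≱ x<a)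
High-prepend⁻ {a} {σ} (x , y , z , inj₁ (_ ∷ʳ p) , a≤x , x<y , y<z)
  with y′ ∷ x′ ∷ z′ ∷ [] , refl , q ← ⊆-map⁻ (bump a) σ p
  = x′ , y′ , z′ , inj₁ q , bump-cancel-≤ a≤x , bump-cancel-< a x<y , bump-cancel-< a y<z
High-prepend⁻ {a} {σ} (x , y , z , inj₂ (_ ∷ʳ p) , a≤x , x<y , y<z)
  with y′ ∷ z′ ∷ x′ ∷ [] , refl , q ← ⊆-map⁻ (bump a) σ p
  = x′ , y′ , z′ , inj₂ q , bump-cancel-≤ a≤x , bump-cancel-< a x<y , bump-cancel-< a y<z

∈-pair : ∀ {x z} {σ : List ℕ} → x ≢ z → x ∈ σ → z ∈ σ → (x ∷ z ∷ []) ⊆ σ ⊎ (z ∷ x ∷ []) ⊆ σ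
∈-pair x≢z (here refl) (here refl) = contradiction refl x≢z
∈-pair x≢z (here refl) (there z∈)  = inj₁ (refl ∷ Sublist.from∈ z∈)
∈-pair x≢z (there x∈)  (here refl) = inj₂ (refl ∷ Sublist.from∈ x∈)
∈-pair x≢z (there x∈)  (there z∈)  = Sum.map (_ ∷ʳ_) (_ ∷ʳ_) (∈-pair x≢z x∈ z∈)

-- The `a` of `σ` is raised to `a + 1`, so the new head lies strictly between it and `b`; the order
-- of these two decides between 213 and 231.
High-prepend-head : ∀ {a b σ} → b < a → b ∈ σ → a ∈ σ → High213∨231 b (prepend a σ)
High-prepend-head {a} {b} b<a b∈ a∈ = bump a b , a , bump a a ,
  Sum.map (λ p → refl ∷ ⊆-map⁺ (bump a) p) (λ p → refl ∷ ⊆-map⁺ (bump a) p) (∈-pair (ℕ.<⇒≢ b<a) b∈ a∈) ,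
  ≤-bump a b , bump-<⁺ b<a , <-bump⁺ ℕ.≤-refl

-- Permutations of [n] by their first letter

HasValues : ℕ → List ℕ → Set
HasValues n σ = (∀ {v} → v ∈ σ → 1 ≤ v × v ≤ n) × (∀ {v} → 1 ≤ v → v ≤ n → v ∈ σ)

[1⋯]-suc : ∀ n → [1⋯ suc n ] ≡ 1 ∷ map suc [1⋯ n ]
[1⋯]-suc n = cong (1 ∷_) (cong (map suc) (sym (map-upTo suc n)))

-- A head of at least 2 is swapped with the 1 behind it; what then follows the 1 is the claim for
-- smaller `a` and `n`, shifted by `suc`.
prepend-[1⋯] : ∀ a n → a ≤ n → prepend (suc a) [1⋯ n ] ↭ [1⋯ suc n ]
prepend-[1⋯] zero n _ = ↭-reflexive (trans
  (cong (1 ∷_) (trans (sym (map-∘ (upTo n))) (map-∘ (upTo n)))) (sym ([1⋯]-suc n)))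
prepend-[1⋯] (suc a) (suc n) (s≤s a≤n) = begin
  2 ℕ.+ a ∷ map (bump (2 ℕ.+ a)) [1⋯ suc n ]
    ≡⟨ cong (λ τ → 2 ℕ.+ a ∷ map (bump (2 ℕ.+ a)) τ) ([1⋯]-suc n) ⟩
  2 ℕ.+ a ∷ 1 ∷ map (bump (2 ℕ.+ a)) (map suc [1⋯ n ])
    ≡⟨ cong (λ τ → 2 ℕ.+ a ∷ 1 ∷ τ) (trans (sym (map-∘ [1⋯ n ])) (map-∘ [1⋯ n ])) ⟩
  2 ℕ.+ a ∷ 1 ∷ map suc (map (bump (suc a)) [1⋯ n ])
    ↭⟨ swap _ _ ↭-refl ⟩
  1 ∷ map suc (prepend (suc a) [1⋯ n ])
    ↭⟨ prep 1 (↭-map⁺ suc (prepend-[1⋯] a n a≤n)) ⟩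
  1 ∷ map suc [1⋯ suc n ]
    ≡⟨ [1⋯]-suc (suc n) ⟨
  [1⋯ 2 ℕ.+ n ] ∎
  where open PermutationReasoning

prepend-permutation⁺ : ∀ {n a σ} → 1 ≤ a → a ≤ suc n → IsPermutationOf n σ →
                       IsPermutationOf (suc n) (prepend a σ)
prepend-permutation⁺ {n} {suc a} _ (s≤s a≤n) σ↭ =
  ↭-trans (prep (suc a) (↭-map⁺ (bump (suc a)) σ↭)) (prepend-[1⋯] a n a≤n)

permutation-values : ∀ {n σ} → IsPermutationOf n σ → HasValues n σ
permutation-values {n} σ↭ =
  (λ v∈ → values n (∈-resp-↭ σ↭ v∈)) ,
  λ 1≤v v≤n → ∈-resp-↭ (↭-sym σ↭) (∈-values n 1≤v v≤n)
  where
  values : ∀ n {v} → v ∈ [1⋯ n ] → 1 ≤ v × v ≤ n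
  values (suc n) {v} v∈ with subst (v ∈_) ([1⋯]-suc n) v∈
  ... | here refl = s≤s z≤n , s≤s z≤n
  ... | there v∈′ with u , u∈ , refl ← ∈-map⁻ suc v∈′ = s≤s z≤n , s≤s (proj₂ (values n u∈))
  ∈-values : ∀ n {v} → 1 ≤ v → v ≤ n → v ∈ [1⋯ n ]
  ∈-values (suc n) {suc zero}    _ _         = here refl
  ∈-values (suc n) {suc (suc v)} _ (s≤s v≤n) =
    subst (2 ℕ.+ v ∈_) (sym ([1⋯]-suc n)) (there (∈-map⁺ suc (∈-values n (s≤s z≤n) v≤n)))

prepend-permutation⁻ : ∀ {n π} → IsPermutationOf (suc n) π →
  ∃₂ λ a σ → π ≡ prepend a σ × 1 ≤ a × a ≤ suc n × IsPermutationOf n σ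
prepend-permutation⁻ {π = []} π↭ with () ← ↭-empty-inv (↭-sym π↭)
prepend-permutation⁻ {n} {a ∷ ρ} π↭ with proj₁ (permutation-values π↭) (here refl)
... | 1≤a@(s≤s {n = a′} z≤n) , a≤1+n@(s≤s a′≤n)
  -- `prepend a [1⋯ n ]` and `a ∷ ρ` rearrange the same list; cancelling the common head exhibits
  -- `ρ` as the image under `bump a` of a rearrangement of `[1⋯ n ]`.
  with σ , refl , σ↭ ← ↭-map-inv (bump a) (drop-∷ (↭-trans (prepend-[1⋯] a′ n a′≤n) (↭-sym π↭)))
  = a , σ , refl , 1≤a , a≤1+n , ↭-sym σ↭

-- Order isomorphism and the three patterns

lookup-map : ∀ (f : ℕ → ℕ) τ i → lookup (map f τ) i ≡ f (lookup τ (Fin.cast (length-map f τ) i))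
lookup-map f (x ∷ τ) zero    = refl
lookup-map f (x ∷ τ) (suc i) = lookup-map f τ i

orderIsomorphic-map : ∀ (f : ℕ → ℕ) τ → (∀ {u v} → u ∈ τ → v ∈ τ → u < v → f u < f v) →
                      OrderIsomorphic (map f τ) τ
orderIsomorphic-map f τ mono = length-map f τ , λ i j →
  mk⇔ (λ lt → reflect (value i) (value j) (subst₂ _<_ (lookup-map f τ i) (lookup-map f τ j) lt))
      (λ lt → subst₂ _<_ (sym (lookup-map f τ i)) (sym (lookup-map f τ j)) (mono (value i) (value j) lt))
  where
  value : ∀ i → lookup τ (Fin.cast (length-map f τ) i) ∈ τ
  value i = ∈-lookup (Fin.cast (length-map f τ) i)
  reflect : ∀ {u v} → u ∈ τ → v ∈ τ → f u < f v → u < v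
  reflect {u} {v} u∈ v∈ lt with ℕ.<-cmp u v
  ... | tri< u<v _ _  = u<v
  ... | tri≈ _ refl _ = contradiction lt (ℕ.<-irrefl refl)
  ... | tri> _ _ v<u  = contradiction lt (ℕ.<-asym (mono v∈ u∈ v<u))

T₁₇ : List (List ℕ)
T₁₇ = (1 ∷ 3 ∷ 2 ∷ 4 ∷ []) ∷ (1 ∷ 3 ∷ 4 ∷ 2 ∷ []) ∷ (4 ∷ 1 ∷ 2 ∷ 3 ∷ []) ∷ []

avoids⇒¬Forbidden : ∀ {π} → π Avoids T₁₇ → ¬ Forbidden π
avoids⇒¬Forbidden {π} (¬1324 ∷ ¬1342 ∷ ¬4123 ∷ []) (w , x , y , z , occurrence , w<x , x<y , y<z) =
  [ (λ p → ¬1324 (_ , p , iso (1 ∷ 3 ∷ 2 ∷ 4 ∷ [])))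
  , [ (λ p → ¬1342 (_ , p , iso (1 ∷ 3 ∷ 4 ∷ 2 ∷ [])))
    , (λ p → ¬4123 (_ , p , iso (4 ∷ 1 ∷ 2 ∷ 3 ∷ []))) ]′ ]′ occurrence
  where
  -- Sends a rank from 1 to 4 to the letter of that rank, so that `map f` of a pattern computes to
  -- its occurrence; the value at 0 is a default.
  f : ℕ → ℕ
  f 0 = 0
  f 1 = w
  f 2 = x
  f 3 = y
  f _ = z
  step : ∀ k → 1 ≤ k → k < 4 → f k < f (suc k)
  step 1 _ _ = w<x
  step 2 _ _ = x<y
  step 3 _ _ = y<z
  step (suc (suc (suc (suc _)))) _ (s≤s (s≤s (s≤s (s≤s ()))))
  mono : ∀ {u} v → 1 ≤ u → v ≤ 4 → u < v → f u < f v
  mono (suc v) 1≤u v<4 u<1+v with ℕ.m≤n⇒m<n∨m≡n (ℕ.s≤s⁻¹ u<1+v)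
  ... | inj₁ u<v  = ℕ.<-trans (mono v 1≤u (ℕ.<⇒≤ v<4) u<v) (step v (ℕ.≤-trans 1≤u (ℕ.<⇒≤ u<v)) v<4)
  ... | inj₂ refl = step v 1≤u v<4
  iso : ∀ τ {_ : True (All.all? (λ v → (1 ℕ.≤? v) ×-dec (v ℕ.≤? 4)) τ)} → OrderIsomorphic (map f τ) τ
  iso τ {ok} = orderIsomorphic-map f τ λ {_} {v} u∈ v∈ →
    mono v (proj₁ (All.lookup (toWitness ok) u∈)) (proj₂ (All.lookup (toWitness ok) v∈))

¬Forbidden⇒avoids : ∀ {π} → ¬ Forbidden π → π Avoids T₁₇
¬Forbidden⇒avoids ¬forbidden =
  (λ { (w ∷ y ∷ x ∷ z ∷ [] , p , refl , iso) → ¬forbidden (w , x , y , z , inj₁ p ,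
         -- Positions 0 and 2 of 1324 carry the ranks 1 and 2, and `ℕ.≤ᵇ⇒≤ 2 2` proves `1 < 2`; all
         -- the other comparisons are of consecutive ranks too.
         from (iso (# 0) (# 2)) (ℕ.≤ᵇ⇒≤ 2 2 _) ,
         from (iso (# 2) (# 1)) (ℕ.≤ᵇ⇒≤ 3 3 _) ,
         from (iso (# 1) (# 3)) (ℕ.≤ᵇ⇒≤ 4 4 _)) }) ∷
  (λ { (w ∷ y ∷ z ∷ x ∷ [] , p , refl , iso) → ¬forbidden (w , x , y , z , inj₂ (inj₁ p) ,
         from (iso (# 0) (# 3)) (ℕ.≤ᵇ⇒≤ 2 2 _) ,
         from (iso (# 3) (# 1)) (ℕ.≤ᵇ⇒≤ 3 3 _) ,
         from (iso (# 1) (# 2)) (ℕ.≤ᵇ⇒≤ 4 4 _)) }) ∷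
  (λ { (z ∷ w ∷ x ∷ y ∷ [] , p , refl , iso) → ¬forbidden (w , x , y , z , inj₂ (inj₂ p) ,
         from (iso (# 1) (# 2)) (ℕ.≤ᵇ⇒≤ 2 2 _) ,
         from (iso (# 2) (# 3)) (ℕ.≤ᵇ⇒≤ 3 3 _) ,
         from (iso (# 3) (# 0)) (ℕ.≤ᵇ⇒≤ 4 4 _)) }) ∷ []
  where open Equivalence using (from)

-- The generating tree

-- full l r is a 123-avoiding σ of length l + r, where l is the least a such that
-- no 213 or 231 of σ has all values ≥ a; l = 0 is the decreasing σ, for which
-- there is no constraint at all. For wide l and narrow l the admissible a are
-- l, …, l + 2 and l, l + 1.
data State : Set where
  full        : (l r : ℕ) → State
  wide narrow : (l : ℕ) → State

-- Covers the values `a`, ..., `a + r - 1`. The sum `a + r` is constant along the recursion: it is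
-- the length of the permutations obtained.
fulls : ℕ → ℕ → List (ℕ × State)
fulls a zero    = []
fulls a (suc r) = (a , full a (suc r)) ∷ fulls (suc a) r

-- The value a to insert, and the state of the result.
children : State → List (ℕ × State)
children (full zero    r) = (suc r , full 0 (suc r)) ∷ fulls 1 r
children (full (suc l) r) =
  (suc l , wide (suc l)) ∷ (suc (suc l ℕ.+ r) , full (suc l) (suc r)) ∷ fulls (suc (suc l)) r
children (wide l)   = (l , wide l) ∷ (suc l , wide (suc l)) ∷ (suc (suc l) , narrow (suc (suc l))) ∷ []
children (narrow l) = (l , wide l) ∷ (suc l , narrow (suc l)) ∷ []

HighThreshold : ℕ → List ℕ → Set
HighThreshold l σ = ¬ High213∨231 l σ × (∀ b → 1 ≤ b → b < l → High213∨231 b σ)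

-- For `full`, the values above `l` are decreasing and, if `1 ≤ l`, `l` precedes `l + 1`. For `wide`
-- and `narrow`, the two `Low123` clauses fix the upper bound at `l + 2` and `l + 1`. An
-- `Ascent k (2 + k)` can only be `k` before `k + 1`; inserting `k` makes it the 123 that bounds the
-- child.
Invariant : ℕ → List ℕ → State → Set
Invariant n σ (full l r) =
  l ℕ.+ r ≡ n × HighThreshold l σ × (∀ d → ¬ Low123 d σ) ×
  (∀ d → ¬ Ascent (suc l) d σ) × (1 ≤ l → l < n × Ascent l (2 ℕ.+ l) σ)
Invariant n σ (wide l) =
  (1 ≤ l × 2 ℕ.+ l ≤ n) × HighThreshold l σ × ¬ Low123 (2 ℕ.+ l) σ × Low123 (3 ℕ.+ l) σ ×
  Ascent l (2 ℕ.+ l) σ × Ascent (1 ℕ.+ l) (3 ℕ.+ l) σ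
Invariant n σ (narrow l) =
  (1 ≤ l × 1 ℕ.+ l ≤ n) × HighThreshold l σ × ¬ Low123 (1 ℕ.+ l) σ × Low123 (2 ℕ.+ l) σ ×
  Ascent l (2 ℕ.+ l) σ

∈-fulls⁻ : ∀ {a t} b r → (a , t) ∈ fulls b r →
           ∃[ r′ ] (t ≡ full a (suc r′) × b ≤ a × a ℕ.+ suc r′ ≡ b ℕ.+ r)
∈-fulls⁻ b (suc r) (here refl) = r , refl , ℕ.≤-refl , refl
∈-fulls⁻ b (suc r) (there a∈) with r′ , t≡ , b<a , eq ← ∈-fulls⁻ (suc b) r a∈ =
  r′ , t≡ , ℕ.<⇒≤ b<a , trans eq (sym (ℕ.+-suc b r))

∈-fulls⁺ : ∀ {a} b r → b ≤ a → a < b ℕ.+ r → ∃[ t ] ((a , t) ∈ fulls b r)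
∈-fulls⁺ {a} b zero    b≤a a<b = contradiction b≤a (ℕ.<⇒≱ (subst (a <_) (ℕ.+-identityʳ b) a<b))
∈-fulls⁺ {a} b (suc r) b≤a a<  with ℕ.m≤n⇒m<n∨m≡n b≤a
... | inj₂ refl = _ , here refl
... | inj₁ b<a  with t , t∈ ← ∈-fulls⁺ (suc b) r b<a (subst (a <_) (ℕ.+-suc b r) a<) = t , there t∈

-- Insertions and the states they lead to

module _ {n : ℕ} {σ : List ℕ} (values : HasValues n σ) where

  -- The threshold of `σ` is forgotten: no 213 or 231 starts at the head and stays above `a`, while
  -- every smaller `b` gets one. The bound `a ≤ n` guarantees an `a` in `σ` to be raised above the
  -- head.
  HighThreshold-insert : ∀ {a} → 1 ≤ a → a ≤ n → ¬ High213∨231 a σ → HighThreshold a (prepend a σ)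
  HighThreshold-insert {a} 1≤a a≤n ¬high =
    ¬high ∘ High-prepend⁻ ,
    λ b 1≤b b<a → High-prepend-head b<a (proj₂ values 1≤b (ℕ.≤-trans (ℕ.<⇒≤ b<a) a≤n)) (proj₂ values 1≤a a≤n)

  prepend-top : prepend (suc n) σ ≡ suc n ∷ σ
  prepend-top = cong (suc n ∷_) (map-id-local (All.tabulate λ v∈σ → bump-< (s≤s (proj₂ (proj₁ values v∈σ)))))

  top-exceeds : ∀ {v τ} → (v ∷ τ) ⊆ σ → ¬ suc n < v
  top-exceeds p n<v = ℕ.<⇒≱ n<v (ℕ.m≤n⇒m≤1+n (proj₂ (proj₁ values (Sublist.lookup p (here refl)))))

  -- A new maximum in front could start a 213, 231, 123 or 12 only with a larger value behind it, so
  -- every condition persists and only `r` grows.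
  full-top : ∀ {l r} → Invariant n σ (full l r) → Invariant (suc n) (suc n ∷ σ) (full l (suc r))
  full-top {l} {r} (l+r≡n , (¬high , high) , ¬low , ¬ascent , ascent) =
    trans (ℕ.+-suc l r) (cong suc l+r≡n) ,
    ((λ { (x , y , z , inj₁ (refl ∷ p) , _ , _ , n<z) → top-exceeds (Sublist.⊆-trans (_ ∷ʳ Sublist.⊆-refl) p) n<z
        ; (x , y , z , inj₂ (refl ∷ p) , _ , _ , n<z) → top-exceeds p n<z
        ; (x , y , z , inj₁ (_ ∷ʳ p) , rest) → ¬high (x , y , z , inj₁ p , rest)
        ; (x , y , z , inj₂ (_ ∷ʳ p) , rest) → ¬high (x , y , z , inj₂ p , rest) })
    , λ b 1≤b b<l → let x , y , z , p , rest = high b 1≤b b<l in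
        x , y , z , Sum.map (_ ∷ʳ_) (_ ∷ʳ_) p , rest) ,
    (λ { d (x , y , z , refl ∷ p , n<y , _) → top-exceeds p n<y
       ; d (x , y , z , _ ∷ʳ p , rest) → ¬low d (x , y , z , p , rest) }) ,
    (λ { d (x , y , refl ∷ p , _ , n<y , _) → top-exceeds p n<y
       ; d (x , y , _ ∷ʳ p , rest) → ¬ascent d (x , y , p , rest) }) ,
    λ 1≤l → let l<n , x , y , p , rest = ascent 1≤l in ℕ.m≤n⇒m≤1+n l<n , x , y , _ ∷ʳ p , rest

  Admissible : ℕ → State → Set
  Admissible a t =
    (1 ≤ a × a ≤ suc n) × ¬ High213∨231 a σ × ¬ Low123 a σ × Invariant (suc n) (prepend a σ) t

  -- The values of `σ` above `l` are decreasing, so `a` completes no 123; it precedes the raised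
  -- `a + 1`, which is the ascent recorded in the new state.
  admissible-full : ∀ {l r a t} → Invariant n σ (full l r) → (a , t) ∈ fulls (suc l) r → Admissible a t
  admissible-full {l} {r} {a} (l+r≡n , (¬high , _) , ¬low , ¬ascent , _) a∈
    with r′ , refl , l<a , a+r′≡1+l+r ← ∈-fulls⁻ (suc l) r a∈
    = (1≤a , ℕ.m≤n⇒m≤1+n a≤n) , ¬highₐ , ¬low a ,
      a+r′≡1+n , HighThreshold-insert 1≤a a≤n ¬highₐ ,
      -- `Low123-prepend⁻` asks for a bound of at least `a`, hence `d + a` in place of `d`.
      (λ d p → [ ¬low _ , ¬ascentₐ _ ]′
        (Low123-prepend⁻ (ℕ.m≤n+m a d) (Low123-mono (ℕ.m≤n⇒m≤1+n (ℕ.m≤m+n d a)) p))) ,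
      (λ d → ¬ascentₐ d ∘ Ascent-prepend⁻ ℕ.≤-refl) ,
      λ _ → s≤s a≤n , Ascent-prepend-head (proj₂ values 1≤a a≤n) ℕ.≤-refl ℕ.≤-refl
    where
    1≤a = ℕ.≤-trans (s≤s z≤n) l<a
    a+r′≡1+n = trans a+r′≡1+l+r (cong suc l+r≡n)
    a≤n : a ≤ n
    a≤n = ℕ.s≤s⁻¹ (subst (a <_) a+r′≡1+n (ℕ.m<m+n a z<s))
    ¬highₐ = ¬high ∘ High-mono (ℕ.<⇒≤ l<a)
    ¬ascentₐ : ∀ d → ¬ Ascent a d σ
    ¬ascentₐ d (x , y , p , a≤x , rest) = ¬ascent d (x , y , p , ℕ.≤-trans l<a a≤x , rest)

  admissible-top : ∀ {l r} → Invariant n σ (full l r) → Admissible (suc n) (full l (suc r))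
  admissible-top {l} {r} inv@(l+r≡n , (¬high , _) , ¬low , _) =
    (s≤s z≤n , ℕ.≤-refl) , ¬high ∘ High-mono l≤1+n , ¬low (suc n) ,
    subst (λ τ → Invariant (suc n) τ (full l (suc r))) (sym prepend-top) (full-top inv)
    where
    l≤1+n : l ≤ suc n
    l≤1+n = ℕ.m≤n⇒m≤1+n (subst (l ≤_) l+r≡n (ℕ.m≤m+n l r))

  -- If `a` precedes `a + 1` in `σ`, inserting `a` creates the 123 on `a`, `a + 1`, `a + 2`; nothing
  -- lower arises and the child is wide. At the upper bound of a wide or narrow node, the lowest old
  -- 123 is carried over with its bound raised by one, which leaves two admissible values: the child
  -- is narrow.
  children-admissible : ∀ s {a t} → Invariant n σ s → (a , t) ∈ children s → Admissible a t
  children-admissible (full zero r) inv@(refl , _) (here refl) = admissible-top inv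
  children-admissible (full zero r) inv (there a∈) = admissible-full inv a∈
  children-admissible (full (suc l) r) (_ , (¬high , _) , ¬low , ¬ascent , ascent) (here refl)
    with l<n , l∧1+l ← ascent (s≤s z≤n)
    = (s≤s z≤n , ℕ.m≤n⇒m≤1+n (ℕ.<⇒≤ l<n)) , ¬high , ¬low _ ,
      (s≤s z≤n , s≤s l<n) , HighThreshold-insert (s≤s z≤n) (ℕ.<⇒≤ l<n) ¬high ,
      [ ¬low _ , ¬Ascent-empty ℕ.≤-refl ]′ ∘ Low123-prepend⁻ (ℕ.n≤1+n _) ,
      Low123-prepend-head l∧1+l ,
      Ascent-prepend-head (proj₂ values (s≤s z≤n) (ℕ.<⇒≤ l<n)) ℕ.≤-refl ℕ.≤-refl ,
      Ascent-prepend⁺ ℕ.≤-refl l∧1+l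
  children-admissible (full (suc l) r) inv@(refl , _) (there (here refl)) = admissible-top inv
  children-admissible (full (suc l) r) inv (there (there a∈)) = admissible-full inv a∈
  children-admissible (wide l) ((1≤l , 2+l≤n) , (¬high , _) , ¬low , low , asc₀ , asc₁) (here refl)
    = (1≤l , l≤1+n) , ¬high , ¬low ∘ Low123-mono (ℕ.m≤n+m l 2) ,
      (1≤l , ℕ.m≤n⇒m≤1+n 2+l≤n) , HighThreshold-insert 1≤l l≤n ¬high ,
      [ ¬low ∘ Low123-mono (ℕ.n≤1+n _) , ¬Ascent-empty ℕ.≤-refl ]′ ∘ Low123-prepend⁻ (ℕ.n≤1+n l) ,
      Low123-prepend-head asc₀ ,
      Ascent-prepend-head (proj₂ values 1≤l l≤n) ℕ.≤-refl ℕ.≤-refl ,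
      Ascent-prepend⁺ ℕ.≤-refl asc₀
    where
    l≤n = ℕ.≤-trans (ℕ.m≤n+m l 2) 2+l≤n
    l≤1+n = ℕ.m≤n⇒m≤1+n l≤n
  children-admissible (wide l) ((1≤l , 2+l≤n) , (¬high , _) , ¬low , low , asc₀ , asc₁)
    (there (here refl))
    = (s≤s z≤n , s≤s (ℕ.<⇒≤ l<n)) , ¬high′ , ¬low ∘ Low123-mono (ℕ.n≤1+n _) ,
      (s≤s z≤n , s≤s 2+l≤n) , HighThreshold-insert (s≤s z≤n) l<n ¬high′ ,
      [ ¬low , ¬Ascent-empty ℕ.≤-refl ]′ ∘ Low123-prepend⁻ (ℕ.n≤1+n _) ,
      Low123-prepend-head asc₁ ,
      Ascent-prepend-head (proj₂ values (s≤s z≤n) l<n) ℕ.≤-refl ℕ.≤-refl ,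
      Ascent-prepend⁺ ℕ.≤-refl asc₁
    where
    l<n = ℕ.≤-trans (ℕ.n≤1+n _) 2+l≤n
    ¬high′ = ¬high ∘ High-mono (ℕ.n≤1+n l)
  children-admissible (wide l) ((1≤l , 2+l≤n) , (¬high , _) , ¬low , low , asc₀ , asc₁)
    (there (there (here refl)))
    = (s≤s z≤n , ℕ.m≤n⇒m≤1+n 2+l≤n) , ¬high′ , ¬low ,
      (s≤s z≤n , s≤s 2+l≤n) , HighThreshold-insert (s≤s z≤n) 2+l≤n ¬high′ ,
      [ ¬low , ¬Ascent-empty (ℕ.n≤1+n _) ]′ ∘ Low123-prepend⁻ ℕ.≤-refl ,
      Low123-prepend⁺ low ,
      Ascent-prepend-head (proj₂ values (s≤s z≤n) 2+l≤n) ℕ.≤-refl ℕ.≤-refl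
    where
    ¬high′ = ¬high ∘ High-mono (ℕ.m≤n+m l 2)
  children-admissible (narrow l) ((1≤l , l<n) , (¬high , _) , ¬low , low , asc) (here refl)
    = (1≤l , ℕ.m≤n⇒m≤1+n l≤n) , ¬high , ¬low ∘ Low123-mono (ℕ.n≤1+n l) ,
      (1≤l , s≤s l<n) , HighThreshold-insert 1≤l l≤n ¬high ,
      [ ¬low , ¬Ascent-empty ℕ.≤-refl ]′ ∘ Low123-prepend⁻ (ℕ.n≤1+n l) ,
      Low123-prepend-head asc ,
      Ascent-prepend-head (proj₂ values 1≤l l≤n) ℕ.≤-refl ℕ.≤-refl ,
      Ascent-prepend⁺ ℕ.≤-refl asc
    where
    l≤n = ℕ.<⇒≤ l<n
  children-admissible (narrow l) ((1≤l , l<n) , (¬high , _) , ¬low , low , asc) (there (here refl))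
    = (s≤s z≤n , ℕ.m≤n⇒m≤1+n l<n) , ¬high′ , ¬low ,
      (s≤s z≤n , s≤s l<n) , HighThreshold-insert (s≤s z≤n) l<n ¬high′ ,
      [ ¬low , ¬Ascent-empty (ℕ.n≤1+n _) ]′ ∘ Low123-prepend⁻ ℕ.≤-refl ,
      Low123-prepend⁺ low ,
      Ascent-prepend-head (proj₂ values (s≤s z≤n) l<n) ℕ.≤-refl ℕ.≤-refl
    where
    ¬high′ = ¬high ∘ High-mono (ℕ.n≤1+n l)

  threshold-≤ : ∀ {a l} → 1 ≤ a → HighThreshold l σ → ¬ High213∨231 a σ → l ≤ a
  threshold-≤ {a} {l} 1≤a (_ , high) ¬high = ℕ.≮⇒≥ λ a<l → ¬high (high a 1≤a a<l)

  low-≤ : ∀ {a d} → Low123 (suc d) σ → ¬ Low123 a σ → a ≤ d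
  low-≤ low ¬low = ℕ.s≤s⁻¹ (ℕ.≰⇒> λ 1+d≤a → ¬low (Low123-mono 1+d≤a low))

  -- The lower bound is the threshold, or 1 for `full zero`; the upper bound is `suc n` for full
  -- nodes and comes from the lowest 123 otherwise.
  children-complete : ∀ s {a} → Invariant n σ s → 1 ≤ a → a ≤ suc n →
                      ¬ High213∨231 a σ → ¬ Low123 a σ → ∃[ t ] ((a , t) ∈ children s)
  children-complete (full zero r) (refl , _) 1≤a a≤1+n ¬high ¬low
    with ℕ.m≤n⇒m<n∨m≡n a≤1+n
  ... | inj₂ refl = _ , here refl
  ... | inj₁ a<1+n with t , t∈ ← ∈-fulls⁺ 1 r 1≤a a<1+n = t , there t∈
  children-complete (full (suc l) r) (refl , threshold , _) 1≤a a≤1+n ¬high ¬low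
    with ℕ.m≤n⇒m<n∨m≡n (threshold-≤ 1≤a threshold ¬high)
  ... | inj₂ refl = _ , here refl
  ... | inj₁ l<a with ℕ.m≤n⇒m<n∨m≡n a≤1+n
  ...   | inj₂ refl = _ , there (here refl)
  ...   | inj₁ a<1+n with t , t∈ ← ∈-fulls⁺ (2 ℕ.+ l) r l<a a<1+n = t , there (there t∈)
  children-complete (wide l) (_ , threshold , _ , low , _) 1≤a _ ¬high ¬low
    with ℕ.m≤n⇒m<n∨m≡n (threshold-≤ 1≤a threshold ¬high)
  ... | inj₂ refl = _ , here refl
  ... | inj₁ l<a with ℕ.m≤n⇒m<n∨m≡n l<a
  ...   | inj₂ refl = _ , there (here refl)
  ...   | inj₁ 1+l<a with refl ← ℕ.≤-antisym 1+l<a (low-≤ low ¬low) = _ , there (there (here refl))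
  children-complete (narrow l) (_ , threshold , _ , low , _) 1≤a _ ¬high ¬low
    with ℕ.m≤n⇒m<n∨m≡n (threshold-≤ 1≤a threshold ¬high)
  ... | inj₂ refl = _ , here refl
  ... | inj₁ l<a with refl ← ℕ.≤-antisym l<a (low-≤ low ¬low) = _ , there (here refl)

-- The levels of the tree and the avoiders

expand : State × List ℕ → List (State × List ℕ)
expand (s , σ) = map (λ (a , t) → t , prepend a σ) (children s)

level : ℕ → List (State × List ℕ)
level zero    = (full 0 0 , []) ∷ []
level (suc n) = concatMap expand (level n)

∈-expand⁻ : ∀ {t π} L → (t , π) ∈ concatMap expand L →
            ∃₂ λ s σ → ∃[ a ] ((s , σ) ∈ L × (a , t) ∈ children s × π ≡ prepend a σ)
∈-expand⁻ ((s , σ) ∷ L) p∈ with ∈-++⁻ (expand (s , σ)) p∈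
... | inj₂ p∈′ with s′ , σ′ , a , q , rest ← ∈-expand⁻ L p∈′ = s′ , σ′ , a , there q , rest
... | inj₁ p∈′ with (a , t) , a∈ , refl ← ∈-map⁻ _ p∈′ = s , σ , a , here refl , a∈ , refl

∈-expand⁺ : ∀ {s σ a t} L → (s , σ) ∈ L → (a , t) ∈ children s → (t , prepend a σ) ∈ concatMap expand L
∈-expand⁺ (_ ∷ L) (here refl) a∈ = ∈-++⁺ˡ (∈-map⁺ _ a∈)
∈-expand⁺ (x ∷ L) (there s∈)  a∈ = ∈-++⁺ʳ (expand x) (∈-expand⁺ L s∈ a∈)

level-sound : ∀ n {s σ} → (s , σ) ∈ level n → IsPermutationOf n σ × ¬ Forbidden σ × Invariant n σ s
level-sound zero (here refl) =
  ↭-refl ,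
  (λ { (_ , _ , _ , _ , inj₁ () , _)
     ; (_ , _ , _ , _ , inj₂ (inj₁ ()) , _)
     ; (_ , _ , _ , _ , inj₂ (inj₂ ()) , _) }) ,
  refl , ((λ { (_ , _ , _ , inj₁ () , _) ; (_ , _ , _ , inj₂ () , _) }) , λ _ _ ()) ,
  (λ { _ (_ , _ , _ , () , _) }) , (λ { _ (_ , _ , () , _) }) , λ ()
level-sound (suc n) p∈ with s , σ , a , s∈ , a∈ , refl ← ∈-expand⁻ (level n) p∈
  with σ↭ , ¬forbidden , inv ← level-sound n s∈
  with (1≤a , a≤1+n) , ¬high , ¬low , inv′ ← children-admissible (permutation-values σ↭) s inv a∈
  = prepend-permutation⁺ 1≤a a≤1+n σ↭ , [ ¬forbidden , [ ¬high , ¬low ]′ ]′ ∘ Forbidden-prepend⁻ a σ , inv′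

-- Removing the first letter leaves an avoider, which lies on the previous level by induction;
-- `level-sound` then supplies the invariant of its state, from which the removed letter is found
-- among the children.
level-complete : ∀ n {π} → IsPermutationOf n π → ¬ Forbidden π → ∃[ s ] ((s , π) ∈ level n)
level-complete zero π↭ _ with refl ← ↭-empty-inv π↭ = full 0 0 , here refl
level-complete (suc n) π↭ ¬forbidden
  with a , σ , refl , 1≤a , a≤1+n , σ↭ ← prepend-permutation⁻ π↭
  with s , s∈ ← level-complete n σ↭ (¬forbidden ∘ Forbidden-prepend⁺ a σ ∘ inj₁)
  with t , a∈ ← children-complete (permutation-values σ↭) s (proj₂ (proj₂ (level-sound n s∈))) 1≤a a≤1+n
                  (¬forbidden ∘ Forbidden-prepend⁺ a σ ∘ inj₂ ∘ inj₁)
                  (¬forbidden ∘ Forbidden-prepend⁺ a σ ∘ inj₂ ∘ inj₂)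
  = t , ∈-expand⁺ (level n) s∈ a∈

fulls-bound : ∀ b r → All (λ (a , _) → b ≤ a × a < b ℕ.+ r) (fulls b r)
fulls-bound b r = All.tabulate λ {(a , _)} a∈ →
  let r′ , _ , b≤a , a+1+r′≡b+r = ∈-fulls⁻ b r a∈ in b≤a , subst (a <_) a+1+r′≡b+r (ℕ.m<m+n a z<s)

insertedValues : List (ℕ × State) → List ℕ
insertedValues = map proj₁

fulls-unique : ∀ b r → Unique (insertedValues (fulls b r))
fulls-unique b zero    = []
fulls-unique b (suc r) =
  All-map⁺ (All.map (λ (b<a , _) → ℕ.<⇒≢ b<a) (fulls-bound (suc b) r)) ∷ fulls-unique (suc b) r

children-unique : ∀ s → Unique (insertedValues (children s))
children-unique (full zero r) =
  All-map⁺ (All.map (λ (_ , a<1+r) → ℕ.>⇒≢ a<1+r) (fulls-bound 1 r)) ∷ fulls-unique 1 r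
children-unique (full (suc l) r) =
  (ℕ.<⇒≢ (s<s (s≤s (ℕ.m≤m+n l r))) ∷ All-map⁺ (All.map (λ (l<a , _) → ℕ.<⇒≢ l<a) bound)) ∷
  All-map⁺ (All.map (λ (_ , a<) → ℕ.>⇒≢ a<) bound) ∷ fulls-unique (2 ℕ.+ l) r
  where bound = fulls-bound (2 ℕ.+ l) r
children-unique (wide l) =
  (ℕ.<⇒≢ (ℕ.n<1+n l) ∷ ℕ.<⇒≢ (ℕ.m<n+m l z<s) ∷ []) ∷ (ℕ.<⇒≢ (ℕ.n<1+n _) ∷ []) ∷ [] ∷ []
children-unique (narrow l) = (ℕ.<⇒≢ (ℕ.n<1+n l) ∷ []) ∷ [] ∷ []

permutations : List (State × List ℕ) → List (List ℕ)
permutations = map proj₂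

-- Both arguments of `prepend a σ` can be recovered: `a` is the head, and `bump a` is injective.
expand-unique : ∀ L → Unique (permutations L) → Unique (permutations (concatMap expand L))
expand-unique [] _ = []
expand-unique ((s , σ) ∷ L) (σ∉ ∷ unique) =
  subst Unique (sym (map-++ proj₂ (expand (s , σ)) (concatMap expand L)))
    (Unique.++⁺ here-unique (expand-unique L unique) disjoint)
  where
  here-unique : Unique (permutations (expand (s , σ)))
  here-unique = subst Unique (trans (sym (map-∘ (children s))) (map-∘ (children s)))
    (Unique.map⁺ {f = λ a → prepend a σ} (λ eq → proj₁ (∷-injective eq)) (children-unique s))
  disjoint : ∀ {π} → ¬ (π ∈ permutations (expand (s , σ)) × π ∈ permutations (concatMap expand L))
  disjoint (π∈ , π∈′)
    with _ , p∈ , refl ← ∈-map⁻ proj₂ π∈ | _ , p∈′ , eq ← ∈-map⁻ proj₂ π∈′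
    with (a , _) , _ , refl ← ∈-map⁻ _ p∈ | s′ , σ′ , a′ , s′∈ , _ , refl ← ∈-expand⁻ L p∈′
    with refl , eq′ ← ∷-injective eq
    = All.lookup σ∉ (∈-map⁺ proj₂ s′∈) (map-injective (bump-injective a) eq′)

level-unique : ∀ n → Unique (permutations (level n))
level-unique zero    = [] ∷ []
level-unique (suc n) = expand-unique (level n) (level-unique n)

-- Two duplicate-free lists with the same members are permutations of each other.
∣S∣≡∣level∣ : ∀ n → ∣S∣ n T₁₇ ≡ length (level n)
∣S∣≡∣level∣ n = trans
  (↭-length (∼bag⇒↭ (unique∧set⇒bag (S-unique n T₁₇) (level-unique n) (mk⇔ to from))))
  (length-map proj₂ (level n))
  where
  to : ∀ {π} → π ∈ S n T₁₇ → π ∈ permutations (level n)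
  to {π} π∈ = let π↭ , avoids = Equivalence.to (∈-S n T₁₇ π) π∈
                  s , s∈ = level-complete n π↭ (avoids⇒¬Forbidden avoids)
              in ∈-map⁺ proj₂ s∈
  from : ∀ {π} → π ∈ permutations (level n) → π ∈ S n T₁₇
  from {π} π∈ with (s , _) , s∈ , refl ← ∈-map⁻ proj₂ π∈ =
    let π↭ , ¬forbidden , _ = level-sound n s∈ in
    Equivalence.from (∈-S n T₁₇ π) (π↭ , ¬Forbidden⇒avoids ¬forbidden)

-- The ring ℤ[[x]]

-- By computation, `(f * g) (suc n)` is `f 0 ℤ.* g (suc n)` plus `(tail f * g) n`; the ring laws are
-- proved by induction along this.
tail : Series → Series
tail f n = f (suc n)

infix 8 -_
-_ : Series → Series
(- f) n = ℤ.- f n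

monomial₀ : ℤ → Series
monomial₀ a zero    = a
monomial₀ a (suc _) = 0ℤ

-- The first clause makes the numeral 1 of the ring solver definitionally 𝟙.
const : ℤ → Series
const (+ 1) = 𝟙
const a     = monomial₀ a

const-monomial₀ : ∀ a → const a ≈ monomial₀ a
const-monomial₀ (+ 0)             n       = refl
const-monomial₀ (+ 1)             zero    = refl
const-monomial₀ (+ 1)             (suc n) = refl
const-monomial₀ (+ suc (suc _))   n       = refl
const-monomial₀ ℤ.-[1+ _ ]        n       = refl

*-cong : ∀ {f f′ g g′} → f ≈ f′ → g ≈ g′ → f * g ≈ f′ * g′
*-cong f≈ g≈ n = *-cong-≤ n (λ i _ → f≈ i) (λ i _ → g≈ i)

*-zeroˡ : ∀ f → 𝟘 * f ≈ 𝟘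
*-zeroˡ f zero    = refl
*-zeroˡ f (suc n) = trans (ℤ.+-identityˡ ((𝟘 * f) n)) (*-zeroˡ f n)

monomial₀-* : ∀ a f → monomial₀ a * f ≈ λ n → a ℤ.* f n
monomial₀-* a f zero    = ℤ.+-identityʳ (a ℤ.* f 0)
monomial₀-* a f (suc n) = trans (cong (λ z → a ℤ.* f (suc n) ℤ.+ z) (*-zeroˡ f n)) (ℤ.+-identityʳ (a ℤ.* f (suc n)))

const-* : ∀ a f → const a * f ≈ λ n → a ℤ.* f n
const-* a f n = trans (*-cong {const a} {monomial₀ a} {f} {f} (const-monomial₀ a) (λ _ → refl) n)
  (monomial₀-* a f n)

*-scaleˡ : ∀ a f g → (λ n → a ℤ.* f n) * g ≈ λ n → a ℤ.* (f * g) n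
*-scaleˡ a f g zero    = lem a (f 0) (g 0)
  where
  lem : ∀ a x y → (a ℤ.* x) ℤ.* y ℤ.+ 0ℤ ≡ a ℤ.* (x ℤ.* y ℤ.+ 0ℤ)
  lem = solve-∀
*-scaleˡ a f g (suc n) = trans
  (cong (λ z → (a ℤ.* f 0) ℤ.* g (suc n) ℤ.+ z) (*-scaleˡ a (tail f) g n))
  (lem a (f 0) (g (suc n)) ((tail f * g) n))
  where
  lem : ∀ a x y z → (a ℤ.* x) ℤ.* y ℤ.+ a ℤ.* z ≡ a ℤ.* (x ℤ.* y ℤ.+ z)
  lem = solve-∀

*-distribʳ-+ : ∀ h f g → (f + g) * h ≈ f * h + g * h
*-distribʳ-+ h f g zero    = lem (f 0) (g 0) (h 0)
  where
  lem : ∀ x y z → (x ℤ.+ y) ℤ.* z ℤ.+ 0ℤ ≡ (x ℤ.* z ℤ.+ 0ℤ) ℤ.+ (y ℤ.* z ℤ.+ 0ℤ)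
  lem = solve-∀
*-distribʳ-+ h f g (suc n) = trans
  (cong (λ z → (f 0 ℤ.+ g 0) ℤ.* h (suc n) ℤ.+ z) (*-distribʳ-+ h (tail f) (tail g) n))
  (lem (f 0) (g 0) (h (suc n)) ((tail f * h) n) ((tail g * h) n))
  where
  lem : ∀ x y z u v → (x ℤ.+ y) ℤ.* z ℤ.+ (u ℤ.+ v) ≡ (x ℤ.* z ℤ.+ u) ℤ.+ (y ℤ.* z ℤ.+ v)
  lem = solve-∀

-- Splits off the last term of the convolution where the definition splits off the first; the two
-- splittings together give commutativity.
tail-*ʳ : ∀ f g n → (f * g) (suc n) ≡ f (suc n) ℤ.* g 0 ℤ.+ (f * tail g) n
tail-*ʳ f g zero    = lem (f 0) (f 1) (g 0) (g 1)
  where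
  lem : ∀ x y u v → x ℤ.* v ℤ.+ (y ℤ.* u ℤ.+ 0ℤ) ≡ y ℤ.* u ℤ.+ (x ℤ.* v ℤ.+ 0ℤ)
  lem = solve-∀
tail-*ʳ f g (suc n) = trans
  (cong (λ z → f 0 ℤ.* g (suc (suc n)) ℤ.+ z) (tail-*ʳ (tail f) g n))
  (lem (f 0 ℤ.* g (suc (suc n))) (f (suc (suc n)) ℤ.* g 0) ((tail f * tail g) n))
  where
  lem : ∀ x y z → x ℤ.+ (y ℤ.+ z) ≡ y ℤ.+ (x ℤ.+ z)
  lem = solve-∀

*-comm : ∀ f g → f * g ≈ g * f
*-comm f g zero    = cong (ℤ._+ 0ℤ) (ℤ.*-comm (f 0) (g 0))
*-comm f g (suc n) = trans
  (cong₂ ℤ._+_ (ℤ.*-comm (f 0) (g (suc n))) (*-comm (tail f) g n))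
  (sym (tail-*ʳ g f n))

*-assoc : ∀ f g h → (f * g) * h ≈ f * (g * h)
*-assoc f g h zero    = lem (f 0) (g 0) (h 0)
  where
  lem : ∀ x y z → (x ℤ.* y ℤ.+ 0ℤ) ℤ.* z ℤ.+ 0ℤ ≡ x ℤ.* (y ℤ.* z ℤ.+ 0ℤ) ℤ.+ 0ℤ
  lem = solve-∀
*-assoc f g h (suc n) = begin
  -- The tail of `f * g` computes to `f 0` times `tail g` plus `tail f * g`.
  (f * g) 0 ℤ.* h (suc n) ℤ.+ (((λ k → f 0 ℤ.* tail g k) + tail f * g) * h) n
    ≡⟨ cong (λ z → (f * g) 0 ℤ.* h (suc n) ℤ.+ z)
         (trans (*-distribʳ-+ h (λ k → f 0 ℤ.* tail g k) (tail f * g) n)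
                (cong₂ ℤ._+_ (*-scaleˡ (f 0) (tail g) h n) (*-assoc (tail f) g h n))) ⟩
  (f * g) 0 ℤ.* h (suc n) ℤ.+ (f 0 ℤ.* (tail g * h) n ℤ.+ (tail f * (g * h)) n)
    ≡⟨ lem (f 0) (g 0) (h (suc n)) ((tail g * h) n) ((tail f * (g * h)) n) ⟩
  f 0 ℤ.* (g * h) (suc n) ℤ.+ (tail f * (g * h)) n ∎
  where
  open ≡-Reasoning
  lem : ∀ x y z u v → (x ℤ.* y ℤ.+ 0ℤ) ℤ.* z ℤ.+ (x ℤ.* u ℤ.+ v) ≡ x ℤ.* (y ℤ.* z ℤ.+ u) ℤ.+ v
  lem = solve-∀

*-identityˡ : ∀ f → 𝟙 * f ≈ f
*-identityˡ f n = trans (const-* 1ℤ f n) (ℤ.*-identityˡ (f n))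

seriesRing : CommutativeRing 0ℓ 0ℓ
seriesRing = record
  { Carrier = Series
  ; _≈_ = _≈_
  ; _+_ = _+_
  ; _*_ = _*_
  ; -_ = -_
  ; 0# = 𝟘
  ; 1# = 𝟙
  ; isCommutativeRing = record
    { isRing = record
      { +-isAbelianGroup = record
        { isGroup = record
          { isMonoid = record
            { isSemigroup = record
              { isMagma = record
                { isEquivalence = record
                  { refl = λ _ → refl
                  ; sym = λ f≈g n → sym (f≈g n)
                  ; trans = λ f≈g g≈h n → trans (f≈g n) (g≈h n)
                  }
                ; ∙-cong = λ f≈ g≈ n → cong₂ ℤ._+_ (f≈ n) (g≈ n)
                }
              ; assoc = λ f g h n → ℤ.+-assoc (f n) (g n) (h n)
              }
            ; identity = (λ f n → ℤ.+-identityˡ (f n)) , (λ f n → ℤ.+-identityʳ (f n))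
            }
          ; inverse = (λ f n → ℤ.+-inverseˡ (f n)) , (λ f n → ℤ.+-inverseʳ (f n))
          ; ⁻¹-cong = λ f≈ n → cong ℤ.-_ (f≈ n)
          }
        ; comm = λ f g n → ℤ.+-comm (f n) (g n)
        }
      ; *-cong = *-cong
      ; *-assoc = *-assoc
      ; *-identity = *-identityˡ , λ f n → trans (*-comm f 𝟙 n) (*-identityˡ f n)
      ; distrib = (λ f g h n → trans (*-comm f (g + h) n) (trans (*-distribʳ-+ f g h n)
                     (cong₂ ℤ._+_ (*-comm g f n) (*-comm h f n))))
                , *-distribʳ-+
      }
    ; *-comm = *-comm
    }
  }

module Ring = CommutativeRing seriesRing

const-homomorphism : ℤ.+-*-rawRing -Raw-AlmostCommutative⟶ fromCommutativeRing seriesRing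
const-homomorphism = record
  { ⟦_⟧    = const
  ; +-homo = λ a b n → trans (const-monomial₀ (a ℤ.+ b) n) (trans (+-monomial₀ a b n)
      (sym (cong₂ ℤ._+_ (const-monomial₀ a n) (const-monomial₀ b n))))
  ; *-homo = λ a b n → trans (const-monomial₀ (a ℤ.* b) n) (trans (*-monomial₀ a b n)
      (trans (cong (λ z → a ℤ.* z) (sym (const-monomial₀ b n))) (sym (const-* a (const b) n))))
  ; -‿homo = λ a n → trans (const-monomial₀ (ℤ.- a) n) (trans (neg-monomial₀ a n)
      (sym (cong ℤ.-_ (const-monomial₀ a n))))
  ; 0-homo = λ { zero → refl ; (suc _) → refl }
  ; 1-homo = λ _ → refl
  }
  where
  +-monomial₀ : ∀ a b → monomial₀ (a ℤ.+ b) ≈ monomial₀ a + monomial₀ b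
  +-monomial₀ a b zero    = refl
  +-monomial₀ a b (suc _) = refl
  *-monomial₀ : ∀ a b n → monomial₀ (a ℤ.* b) n ≡ a ℤ.* monomial₀ b n
  *-monomial₀ a b zero    = refl
  *-monomial₀ a b (suc _) = sym (ℤ.*-zeroʳ a)
  neg-monomial₀ : ∀ a → monomial₀ (ℤ.- a) ≈ - monomial₀ a
  neg-monomial₀ a zero    = refl
  neg-monomial₀ a (suc _) = refl

const-≟ : ∀ a b → Maybe (const a ≈ const b)
const-≟ a b with a ℤ.≟ b
... | yes refl = just (λ _ → refl)
... | no  _    = nothing

open Algebra.Solver.Ring ℤ.+-*-rawRing (fromCommutativeRing seriesRing) const-homomorphism const-≟
  using (Polynomial; solve; _:=_; _:+_; _:-_; _:*_; :-_; con)

-- Cancellation, square roots and the Catalan series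

·-const : ∀ m f → m · f ≈ const (+ m) * f
·-const m f n = sym (const-* (+ m) f n)

*-congˡ : ∀ f f′ g → f ≈ f′ → f * g ≈ f′ * g
*-congˡ f f′ g f≈ = *-cong {f} {f′} {g} {g} f≈ (λ _ → refl)

X*-suc : ∀ f n → (X * f) (suc n) ≡ f n
X*-suc f n = trans (ℤ.+-identityˡ ((tail X * f) n))
  (trans (*-cong {tail X} {𝟙} {f} {f} (λ { zero → refl ; (suc _) → refl }) (λ _ → refl) n) (*-identityˡ f n))

-- Turns a recursion for coefficients into a functional equation; for `W`, `N` and `G` the tail is
-- by definition a combination of these series.
≈𝟙+X*tail : ∀ f → f 0 ≡ 1ℤ → f ≈ 𝟙 + X * tail f
≈𝟙+X*tail f f0 zero    = trans f0 refl
≈𝟙+X*tail f f0 (suc n) = sym (trans (ℤ.+-identityˡ _) (X*-suc (tail f) n))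

product-vanishes : ∀ (f g : Series) n → (∀ i → i < n → f i ≡ 0ℤ) → (f * g) n ≡ f n ℤ.* g 0
product-vanishes f g zero    _   = ℤ.+-identityʳ (f 0 ℤ.* g 0)
product-vanishes f g (suc n) f≡0 = trans
  (cong₂ (λ a b → a ℤ.* g (suc n) ℤ.+ b) (f≡0 0 (s≤s z≤n))
    (product-vanishes (tail f) g n (λ i i<n → f≡0 (suc i) (s≤s i<n))))
  (ℤ.+-identityˡ (f (suc n) ℤ.* g 0))

-- Strong induction: if `f` vanishes below degree `n`, the coefficient of the product at `n` is
-- `f n ℤ.* g 0`.
*-cancel-𝟘 : ∀ f g → g 0 ≢ 0ℤ → f * g ≈ 𝟘 → f ≈ 𝟘
*-cancel-𝟘 f g g0≢0 fg≈0 = <-rec _ λ n rec →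
  case ℤ.i*j≡0⇒i≡0∨j≡0 (f n) (trans (sym (product-vanishes f g n (λ _ i<n → rec i<n))) (fg≈0 n)) of λ where
    (inj₁ fn≡0) → fn≡0
    (inj₂ g0≡0) → contradiction g0≡0 g0≢0

-- The product of `s - t` and `s + t` is zero, and `s + t` has constant term 2.
sqrt-unique : ∀ {f s t} → s IsSqrtOf f → t IsSqrtOf f → s ≈ t
sqrt-unique {f} {s} {t} (s0 , s²) (t0 , t²) n = ℤ.i-j≡0⇒i≡j (s n) (t n) (s-t≈𝟘 n)
  where
  s+t≢0 : (s + t) 0 ≢ 0ℤ
  s+t≢0 eq = case trans (sym eq) (cong₂ ℤ._+_ s0 t0) of λ ()
  factor : (s - t) * (s + t) ≈ s * s - t * t
  factor = solve 2 (λ s t → (s :- t) :* (s :+ t) := s :* s :- t :* t) (λ _ → refl) s t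
  s-t≈𝟘 : s - t ≈ 𝟘
  s-t≈𝟘 = *-cancel-𝟘 (s - t) (s + t) s+t≢0 λ n → trans (factor n)
    (trans (cong₂ ℤ._-_ (s² n) (t² n)) (ℤ.+-inverseʳ (f n)))

√[1-4X]-catalan : √[1-4X] ≈ 𝟙 - const (+ 2) * (X * catalan)
√[1-4X]-catalan zero    = refl
√[1-4X]-catalan (suc n) = trans (lem (catalan n))
  (cong (λ z → 0ℤ ℤ.- z) (sym (trans (const-* (+ 2) (X * catalan) (suc n)) (cong (λ z → + 2 ℤ.* z) (X*-suc catalan n)))))
  where
  lem : ∀ c → ℤ.- (+ 2) ℤ.* c ≡ 0ℤ ℤ.- (+ 2) ℤ.* c
  lem = solve-∀

catalan-equation : catalan ≈ 𝟙 + X * (catalan * catalan)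
catalan-equation zero    = refl
catalan-equation (suc n) = trans (catalan-suc n) (sym (trans (ℤ.+-identityˡ _) (X*-suc (catalan * catalan) n)))

-- Counting the nodes of the tree

total : ∀ {A : Set} → (A → ℤ) → List A → ℤ
total φ = foldr (λ x z → φ x ℤ.+ z) 0ℤ

-- W = 1/(1 - 3x + x²) and N = (1 - x)/(1 - 3x + x²) count the descendants of a
-- wide and of a narrow node, and G = 1/(1 - x).
W N G Y : Series
W zero    = 1ℤ
W (suc n) = W n ℤ.+ (W n ℤ.+ N n)
N zero    = 1ℤ
N (suc n) = W n ℤ.+ N n
G _ = 1ℤ
Y = 𝟙 + X * W

-- The coefficient of xᵏ in weight s is the number of k-th generation descendants
-- of a node of state s.
weight : State → Series
weight (full zero    r) = catalan ^ suc r * Y - X * (W * G)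
weight (full (suc _) r) = catalan ^ suc r * Y
weight (wide _)         = W
weight (narrow _)       = N

catalan^-zero : ∀ r → (catalan ^ r) 0 ≡ 1ℤ
catalan^-zero zero    = refl
catalan^-zero (suc r) = cong (λ z → 1ℤ ℤ.* z ℤ.+ 0ℤ) (catalan^-zero r)

catalan^*Y-zero : ∀ r → (catalan ^ r * Y) 0 ≡ 1ℤ
catalan^*Y-zero r = cong (λ z → z ℤ.* 1ℤ ℤ.+ 0ℤ) (catalan^-zero r)

weight-zero : ∀ s → weight s 0 ≡ 1ℤ
weight-zero (full zero    r) = cong (ℤ._- 0ℤ) (catalan^*Y-zero (suc r))
weight-zero (full (suc l) r) = catalan^*Y-zero (suc r)
weight-zero (wide l)         = refl
weight-zero (narrow l)       = refl

Y-suc : ∀ n → Y (suc n) ≡ W n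
Y-suc n = trans (ℤ.+-identityˡ _) (X*-suc W n)

catalan*P*Y : ∀ P → catalan * P * Y ≈ P * Y + X * (catalan * (catalan * P) * Y)
catalan*P*Y P n = trans
  (*-congˡ (catalan * P) ((𝟙 + X * (catalan * catalan)) * P) Y
    (*-congˡ catalan (𝟙 + X * (catalan * catalan)) P catalan-equation) n)
  (solve 4 (λ x c p y → (con 1ℤ :+ x :* (c :* c)) :* p :* y
                        := p :* y :+ x :* (c :* (c :* p) :* y)) (λ _ → refl) X catalan P Y n)

catalan*P*Y-suc : ∀ P n → (catalan * P * Y) (suc n) ≡ (P * Y) (suc n) ℤ.+ (catalan * (catalan * P) * Y) n
catalan*P*Y-suc P n = trans (catalan*P*Y P (suc n))
  (cong (λ z → (P * Y) (suc n) ℤ.+ z) (X*-suc (catalan * (catalan * P) * Y) n))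

weightOf : ℕ → ℕ × State → ℤ
weightOf n (_ , s) = weight s n

-- A telescoping sum: `catalan*P*Y` splits `catalan ^ suc r * Y` into `catalan ^ r * Y` and `X`
-- times `catalan ^ suc (suc r) * Y`. At exponent 0 there remains `Y`, whose tail is `W`, the share
-- of a wide child.
total-fulls : ∀ a r n → total (weightOf n) (fulls (suc a) r) ℤ.+ (catalan ^ suc (suc r) * Y) n ℤ.+ W n
                        ≡ (catalan ^ suc r * Y) (suc n)
total-fulls a zero    n = begin
  0ℤ ℤ.+ (catalan ^ 2 * Y) n ℤ.+ W n ≡⟨ lem ((catalan ^ 2 * Y) n) (W n) ⟩
  W n ℤ.+ (catalan ^ 2 * Y) n
    ≡⟨ cong (λ z → z ℤ.+ (catalan ^ 2 * Y) n) (trans (sym (Y-suc n)) (sym (*-identityˡ Y (suc n)))) ⟩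
  (𝟙 * Y) (suc n) ℤ.+ (catalan ^ 2 * Y) n ≡⟨ catalan*P*Y-suc 𝟙 n ⟨
  (catalan ^ 1 * Y) (suc n) ∎
  where
  open ≡-Reasoning
  lem : ∀ x y → 0ℤ ℤ.+ x ℤ.+ y ≡ y ℤ.+ x
  lem = solve-∀
total-fulls a (suc r) n = begin
  C₂ ℤ.+ R ℤ.+ C₃ ℤ.+ W n                       ≡⟨ lem C₂ R C₃ (W n) ⟩
  R ℤ.+ C₂ ℤ.+ W n ℤ.+ C₃                       ≡⟨ cong (λ z → z ℤ.+ C₃) (total-fulls (suc a) r n) ⟩
  (catalan ^ suc r * Y) (suc n) ℤ.+ C₃          ≡⟨ catalan*P*Y-suc (catalan ^ suc r) n ⟨
  (catalan ^ suc (suc r) * Y) (suc n)           ∎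
  where
  open ≡-Reasoning
  C₂ = (catalan ^ suc (suc r) * Y) n
  C₃ = (catalan ^ suc (suc (suc r)) * Y) n
  R  = total (weightOf n) (fulls (suc (suc a)) r)
  lem : ∀ x y z w → x ℤ.+ y ℤ.+ z ℤ.+ w ≡ y ℤ.+ x ℤ.+ w ℤ.+ z
  lem = solve-∀

-- The series `X * (W * G)` is the correction for decreasing nodes: `full 0 r` and its descendants
-- `full 0 (suc r)`, ... each lack one wide child.
W*G-suc : ∀ n → (X * (W * G)) (suc n) ≡ W n ℤ.+ (X * (W * G)) n
W*G-suc zero    = refl
W*G-suc (suc n) = begin
  (X * (W * G)) (suc (suc n))              ≡⟨ X*-suc (W * G) (suc n) ⟩
  (W * G) (suc n)                          ≡⟨ tail-*ʳ W G n ⟩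
  W (suc n) ℤ.* 1ℤ ℤ.+ (W * G) n           ≡⟨ cong₂ ℤ._+_ (ℤ.*-identityʳ (W (suc n))) (sym (X*-suc (W * G) n)) ⟩
  W (suc n) ℤ.+ (X * (W * G)) (suc n)      ∎
  where open ≡-Reasoning

weight-suc : ∀ s n → weight s (suc n) ≡ total (weightOf n) (children s)
weight-suc (full zero r) n = begin
  (catalan ^ suc r * Y) (suc n) ℤ.- (X * (W * G)) (suc n)
    ≡⟨ cong₂ ℤ._-_ (sym (total-fulls 0 r n)) (W*G-suc n) ⟩
  R ℤ.+ C₂ ℤ.+ W n ℤ.- (W n ℤ.+ (X * (W * G)) n)
    ≡⟨ lem R C₂ (W n) ((X * (W * G)) n) ⟩
  C₂ ℤ.- (X * (W * G)) n ℤ.+ R ∎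
  where
  open ≡-Reasoning
  C₂ = (catalan ^ suc (suc r) * Y) n
  R  = total (weightOf n) (fulls 1 r)
  lem : ∀ x y z w → x ℤ.+ y ℤ.+ z ℤ.- (z ℤ.+ w) ≡ y ℤ.- w ℤ.+ x
  lem = solve-∀
weight-suc (full (suc l) r) n = trans (sym (total-fulls (suc l) r n))
  (lem (total (weightOf n) (fulls (suc (suc l)) r)) ((catalan ^ suc (suc r) * Y) n) (W n))
  where
  lem : ∀ x y z → x ℤ.+ y ℤ.+ z ≡ z ℤ.+ (y ℤ.+ x)
  lem = solve-∀
weight-suc (wide l)   n = cong (λ z → W n ℤ.+ (W n ℤ.+ z)) (sym (ℤ.+-identityʳ (N n)))
weight-suc (narrow l) n = cong (λ z → W n ℤ.+ z) (sym (ℤ.+-identityʳ (N n)))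

-- The closed form of the root weight

-- Makes the ring solver work modulo two equations: it only has to verify a polynomial identity with
-- explicit multiples of the differences of their sides.
drop-multiples : ∀ p α {a a′} β {b b′} → a ≈ a′ → b ≈ b′ → p + α * (a - a′) + β * (b - b′) ≈ p
drop-multiples p α {a} {a′} β {b} {b′} a≈a′ b≈b′ n = trans
  (cong₂ (λ y z → p n ℤ.+ y ℤ.+ z) (vanishes α a a′ a≈a′) (vanishes β b b′ b≈b′))
  (trans (ℤ.+-identityʳ _) (ℤ.+-identityʳ (p n)))
  where
  vanishes : ∀ α a a′ → a ≈ a′ → (α * (a - a′)) n ≡ 0ℤ
  vanishes α a a′ a≈a′ = trans
    (*-cong {α} {α} {a - a′} {𝟘} (λ _ → refl)
      (λ k → trans (cong (λ z → z ℤ.- a′ k) (a≈a′ k)) (ℤ.+-inverseʳ (a′ k))) n)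
    (Ring.zeroʳ α n)

W-equation : W * (𝟙 - const (+ 3) * X + X * X) ≈ 𝟙
W-equation n = trans
  -- The multipliers `1 - x` and `x` are chosen to cancel `v`, which stands for `N`.
  (solve 3 (λ x w v → w :* (con 1ℤ :- con (+ 3) :* x :+ x :* x)
     := con 1ℤ :+ (con 1ℤ :- x) :* (w :- (con 1ℤ :+ x :* (w :+ (w :+ v))))
               :+ x :* (v :- (con 1ℤ :+ x :* (w :+ v)))) (λ _ → refl) X W N n)
  (drop-multiples 𝟙 (𝟙 - X) X (≈𝟙+X*tail W refl) (≈𝟙+X*tail N refl) n)

G-equation : (𝟙 - X) * G ≈ 𝟙
G-equation n = trans
  (solve 2 (λ x g → (con 1ℤ :- x) :* g
     := con 1ℤ :+ con 1ℤ :* (g :- (con 1ℤ :+ x :* g)) :+ con 0ℤ :* (g :- g)) (λ _ → refl) X G n)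
  (drop-multiples 𝟙 𝟙 (const 0ℤ) {G} {b′ = G} (≈𝟙+X*tail G refl) (λ _ → refl) n)

-- Replaces the scalings `m · f` by products with constants, which the solver can read.
denominator≈ : 2 · X * (𝟙 - 4 · X + 4 · X ^ 2 - X ^ 3)
             ≈ const (+ 2) * X * (𝟙 - const (+ 4) * X + const (+ 4) * X ^ 2 - X ^ 3)
denominator≈ = *-cong (·-const 2 X) λ n →
  cong₂ (λ y z → 𝟙 n ℤ.- y ℤ.+ z ℤ.- (X ^ 3) n) (·-const 4 X n) (·-const 4 (X ^ 2) n)

numerator≈ : ∀ s → s ≈ √[1-4X] → 𝟙 - 3 · X + X ^ 2 - X ^ 3 - (𝟙 - X) ^ 3 * s
  ≈ 𝟙 - const (+ 3) * X + X ^ 2 - X ^ 3 - (𝟙 - X) ^ 3 * (𝟙 - const (+ 2) * (X * catalan))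
numerator≈ s s≈ n = cong₂ (λ y z → 𝟙 n ℤ.- y ℤ.+ (X ^ 2) n ℤ.- (X ^ 3) n ℤ.- z)
  (·-const 3 X n)
  (*-cong {(𝟙 - X) ^ 3} {(𝟙 - X) ^ 3} {s} (λ _ → refl) (λ k → trans (s≈ k) (√[1-4X]-catalan k)) n)

-- The cubic in the denominator factors as `D * K`, and `D`, `K` are the inverses of `G`, `W`;
-- multiplying by it therefore leaves a polynomial in `X` and `catalan`.
root-weight : weight (full 0 0) * (const (+ 2) * X * (𝟙 - const (+ 4) * X + const (+ 4) * X ^ 2 - X ^ 3))
  ≈ 𝟙 - const (+ 3) * X + X ^ 2 - X ^ 3 - (𝟙 - X) ^ 3 * (𝟙 - const (+ 2) * (X * catalan))
root-weight n = begin
  (weight (full 0 0) * (const (+ 2) * X * (𝟙 - const (+ 4) * X + const (+ 4) * X ^ 2 - X ^ 3))) n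
    ≡⟨ *-cong {weight (full 0 0)} (λ _ → refl) (*-cong {const (+ 2) * X} (λ _ → refl) factor) n ⟩
  (weight (full 0 0) * (const (+ 2) * X * (D * K))) n
    ≡⟨ solve 6 (λ x c w g d k →
         (c :* con 1ℤ :* (con 1ℤ :+ x :* w) :- x :* (w :* g)) :* (con (+ 2) :* x :* (d :* k))
         := con (+ 2) :* x :* (c :* (d :* k) :+ x :* (c :* d) :- x)
            :+ (con (+ 2) :* x :* x :* (c :* d :- d :* g)) :* (w :* k :- con 1ℤ)
            :+ (:- (con (+ 2) :* x :* x)) :* (d :* g :- con 1ℤ))
         (λ _ → refl) X catalan W G D K n ⟩
  (combination + (const (+ 2) * X * X * (catalan * D - D * G)) * (W * K - 𝟙)
    + (- (const (+ 2) * X * X)) * (D * G - 𝟙)) n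
    ≡⟨ drop-multiples combination (const (+ 2) * X * X * (catalan * D - D * G)) (- (const (+ 2) * X * X))
         W-equation G-equation n ⟩
  combination n
    -- The coefficient of `c` is `2x` times `d (k + x)`, and `k + x` is the square of `d`: this is
    -- the source of the cube in front of the square root.
    ≡⟨ solve 2 (λ x c →
         let d = con 1ℤ :- x; k = con 1ℤ :- con (+ 3) :* x :+ x :* x in
         con (+ 2) :* x :* (c :* (d :* k) :+ x :* (c :* d) :- x)
         := con 1ℤ :- con (+ 3) :* x :+ x :* (x :* con 1ℤ) :- x :* (x :* (x :* con 1ℤ))
            :- d :* (d :* (d :* con 1ℤ)) :* (con 1ℤ :- con (+ 2) :* (x :* c)))
         (λ _ → refl) X catalan n ⟩
  (𝟙 - const (+ 3) * X + X ^ 2 - X ^ 3 - (𝟙 - X) ^ 3 * (𝟙 - const (+ 2) * (X * catalan))) n ∎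
  where
  open ≡-Reasoning
  D = 𝟙 - X
  K = 𝟙 - const (+ 3) * X + X * X
  combination = const (+ 2) * X * (catalan * (D * K) + X * (catalan * D) - X)
  factor : 𝟙 - const (+ 4) * X + const (+ 4) * X ^ 2 - X ^ 3 ≈ D * K
  factor = solve 1 (λ x →
    con 1ℤ :- con (+ 4) :* x :+ con (+ 4) :* (x :* (x :* con 1ℤ)) :- x :* (x :* (x :* con 1ℤ))
    := (con 1ℤ :- x) :* (con 1ℤ :- con (+ 3) :* x :+ x :* x)) (λ _ → refl) X

denominator≉𝟘 : ¬ (2 · X * (𝟙 - 4 · X + 4 · X ^ 2 - X ^ 3) ≈ 𝟘)
-- The coefficient of `X` is 2.
denominator≉𝟘 q≈𝟘 = case q≈𝟘 1 of λ ()

algebraic-form : ∀ f s → f ≈ weight (full 0 0) → s IsSqrtOf (𝟙 - 4 · X) →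
  f ≈[ 𝟙 - 3 · X + X ^ 2 - X ^ 3 - (𝟙 - X) ^ 3 * s / 2 · X * (𝟙 - 4 · X + 4 · X ^ 2 - X ^ 3) ]
algebraic-form f s f≈ s² = denominator≉𝟘 , λ n →
  trans (*-cong {f} {weight (full 0 0)} f≈ denominator≈ n)
    (trans (root-weight n) (sym (numerator≈ s (sqrt-unique s² √[1-4X]-isSqrt) n)))

-- Summing weights over a level

nodeWeight : ℕ → State × List ℕ → ℤ
nodeWeight k (s , _) = weight s k

total-expand : ∀ k L → total (nodeWeight k) (concatMap expand L) ≡ total (nodeWeight (suc k)) L
total-expand k []            = refl
total-expand k ((s , σ) ∷ L) = begin
  total (nodeWeight k) (expand (s , σ) ++ concatMap expand L)
    ≡⟨ total-++ (expand (s , σ)) ⟩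
  total (nodeWeight k) (expand (s , σ)) ℤ.+ total (nodeWeight k) (concatMap expand L)
    ≡⟨ cong₂ ℤ._+_ (trans (total-map (children s)) (sym (weight-suc s k))) (total-expand k L) ⟩
  weight s (suc k) ℤ.+ total (nodeWeight (suc k)) L ∎
  where
  open ≡-Reasoning
  total-++ : ∀ L {L′} → total (nodeWeight k) (L ++ L′) ≡ total (nodeWeight k) L ℤ.+ total (nodeWeight k) L′
  total-++ []      = sym (ℤ.+-identityˡ _)
  total-++ (x ∷ L) = trans (cong (λ z → nodeWeight k x ℤ.+ z) (total-++ L)) (sym (ℤ.+-assoc (nodeWeight k x) _ _))
  total-map : ∀ cs → total (nodeWeight k) (map (λ (a , t) → t , prepend a σ) cs) ≡ total (weightOf k) cs
  total-map []       = refl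
  total-map (c ∷ cs) = cong (λ z → weightOf k c ℤ.+ z) (total-map cs)

-- Descending one level trades one generation of `k` for one of `n`. At `k = 0` every node has
-- weight 1, so the sum is the size of the level.
total-level : ∀ n k → total (nodeWeight k) (level n) ≡ weight (full 0 0) (n ℕ.+ k)
total-level zero    k = ℤ.+-identityʳ _
total-level (suc n) k = trans (total-expand k (level n))
  (trans (total-level n (suc k)) (cong (weight (full 0 0)) (ℕ.+-suc n k)))

total-zero : ∀ L → total (nodeWeight 0) L ≡ + length L
total-zero []            = refl
total-zero ((s , _) ∷ L) = cong₂ ℤ._+_ (weight-zero s) (total-zero L)

F≈root-weight : F T₁₇ ≈ weight (full 0 0)
F≈root-weight n = begin
  + ∣S∣ n T₁₇                       ≡⟨ cong +_ (∣S∣≡∣level∣ n) ⟩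
  + length (level n)              ≡⟨ total-zero (level n) ⟨
  total (nodeWeight 0) (level n)  ≡⟨ total-level n 0 ⟩
  weight (full 0 0) (n ℕ.+ 0)     ≡⟨ cong (weight (full 0 0)) (ℕ.+-identityʳ n) ⟩
  weight (full 0 0) n             ∎
  where open ≡-Reasoning

theorem17 : let T : List (List ℕ)
                T = (1 ∷ 3 ∷ 2 ∷ 4 ∷ []) ∷ (1 ∷ 3 ∷ 4 ∷ 2 ∷ []) ∷ (4 ∷ 1 ∷ 2 ∷ 3 ∷ []) ∷ []
    in ∀ (√1-4x : Series) → √1-4x IsSqrtOf (𝟙 - 4 · X) →
       F T ≈[ 𝟙 - 3 · X + X ^ 2 - X ^ 3 - (𝟙 - X) ^ 3 * √1-4x
            / 2 · X * (𝟙 - 4 · X + 4 · X ^ 2 - X ^ 3) ]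
theorem17 √1-4x isSqrt = algebraic-form (F T₁₇) √1-4x F≈root-weight isSqrt
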